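{- For $1\le i\le r$, $C_{i,r}=G_{i,r-i+2}$.
   Context: Bernoulli numbers $B_n$: $\sum_{n\ge0}B_n x^n/n! = xe^x/(e^x-1)$. For $1\le i\le r$, $C_{i,r}=(-1)^r\sum\prod_{j=1}^rB_{n_j}/n_j!$, the sum over $(n_1,\dots,n_r)\in\mathbb Z_{\ge0}^r$ with $n_1+\dots+n_r=r$, $n_1+\dots+n_j<j$ ($1\le j<i$), and $n_{j+1}+\dots+n_r\le r-j$ ($i\le j<r$). (These are the coefficients of $(\epsilon_i+\dots+\epsilon_r)/(\epsilon_1+\dots+\epsilon_r)$-type terms in the asymptotic expansion of the Euler–Zagier multiple zeta function $\zeta(\epsilon_1,\dots,\epsilon_r)$ at the origin.) The generalized Gregory coefficients $G_{m,n}\in\mathbb Q$ ($m,n\ge0$) are defined by the formal power series identity \[ \sum_{m,n\ge0}G_{m,n}x^my^n=\frac{y\log^2(1+x)-x\log^2(1+y)}{\log(1+x)-\log(1+y)}, \] where $\log^k u=(\log u)^k$. -}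

module Defs where

open import Algebra.Definitions.RawSemiring using (_^_)
open import Algebra.Properties.CommutativeMonoid.Sum using (sum-syntax)
open import Data.Fin.Base using (toℕ)
open import Data.Integer.Base as ℤ using (+_)
open import Data.List.Base as List using (List; []; _∷_; upTo; cartesianProductWith)
open import Data.Nat.Base as ℕ using (ℕ; zero; suc; _∸_; _≤_; _<_; _!)
open import Data.Nat.ListAction using (sum)
open import Data.Nat.Properties as ℕₚ using (_!≢0; allUpTo?)
open import Data.Product.Base using (_×_)
open import Data.Rational.Base
  using (ℚ; 0ℚ; 1ℚ; -_; _+_; _-_; _*_; _/_; +-*-rawSemiring)
open import Data.Rational.Properties using (+-0-commutativeMonoid)
open import Data.Vec.Base as Vec using (Vec; toList)
open import Relation.Binary.PropositionalEquality.Core using (_≡_)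
open import Relation.Nullary.Decidable.Core using (Dec; _×-dec_; _→-dec_)

∑< : (n : ℕ) → (ℕ → ℚ) → ℚ
∑< n f = sum-syntax +-0-commutativeMonoid n (λ k → f (toℕ k))

-1^_ : ℕ → ℚ
-1^ n = _^_ +-*-rawSemiring (- 1ℚ) n

1/_! : ℕ → ℚ
1/ n ! = _/_ (+ 1) (n !) {{n !≢0}}

-- Formal power series over ℚ in one variable x, given by coefficients.
Series : Set
Series = ℕ → ℚ

infix 4 _≈₁_ _≈₂_
infixl 6 _-₁_ _-₂_
infixl 7 _*₁_ _*₂_

_≈₁_ : Series → Series → Set
f ≈₁ g = ∀ n → f n ≡ g n

_-₁_ : Series → Series → Series
(f -₁ g) n = f n - g n

_*₁_ : Series → Series → Series
(f *₁ g) n = ∑< (suc n) λ k → f k * g (n ∸ k)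

one : Series
one zero    = 1ℚ
one (suc _) = 0ℚ

var : Series
var 1 = 1ℚ
var _ = 0ℚ

exp : Series
exp n = 1/ n !

-- log (1 + x) = ∑_{k ≥ 1} (-1)^{k-1} x^k / k
log1+ : Series
log1+ zero    = 0ℚ
log1+ (suc k) = -1^ k * (+ 1 / suc k)

-- Formal power series in x and y: F m n is the coefficient of x^m y^n.
Series₂ : Set
Series₂ = ℕ → ℕ → ℚ

_≈₂_ : Series₂ → Series₂ → Set
F ≈₂ G = ∀ m n → F m n ≡ G m n

_-₂_ : Series₂ → Series₂ → Series₂
(F -₂ G) m n = F m n - G m n

_*₂_ : Series₂ → Series₂ → Series₂
(F *₂ G) m n =
  ∑< (suc m) λ k → ∑< (suc n) λ l → F k l * G (m ∸ k) (n ∸ l)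

-- f(x) and f(y) as two-variable series.
inX : Series → Series₂
inX f m zero    = f m
inX f m (suc _) = 0ℚ

inY : Series → Series₂
inY f zero    n = f n
inY f (suc _) n = 0ℚ

-- ∑ B_n x^n / n! = x e^x / (e^x - 1), so that B_1 = +1/2.  The fraction is
-- written with its denominator cleared; as e^x - 1 is x times a unit, exactly
-- one B satisfies this.
IsBernoulli : (ℕ → ℚ) → Set
IsBernoulli B = (λ n → B n * 1/ n !) *₁ (exp -₁ one) ≈₁ var *₁ exp

-- ∑ G_{m,n} x^m y^n
--   = (y log²(1+x) - x log²(1+y)) / (log(1+x) - log(1+y)),
-- again with the denominator cleared.  The denominator is x - y times a unit
-- and the numerator vanishes at x = y, so exactly one G satisfies this.
IsGregory : (ℕ → ℕ → ℚ) → Set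
IsGregory G = G *₂ (Lx -₂ Ly) ≈₂ y *₂ (Lx *₂ Lx) -₂ x *₂ (Ly *₂ Ly)
  where
  x y Lx Ly : Series₂
  x  = inX var
  y  = inY var
  Lx = inX log1+
  Ly = inY log1+

-- The tuple (n₁, …, n_r) is a vector, so n₁ + … + n_j is the sum of
-- `take j` and n_{j+1} + … + n_r the sum of `drop j`.
Admissible : (i r : ℕ) → Vec ℕ r → Set
Admissible i r v =
    sum ns ≡ r
  × (∀ {j} → j < i → 1 ≤ j → sum (List.take j ns) < j)
  × (∀ {j} → j < r → i ≤ j → sum (List.drop j ns) ≤ r ∸ j)
  where
  ns : List ℕ
  ns = toList v

admissible? : ∀ i r (v : Vec ℕ r) → Dec (Admissible i r v)
admissible? i r v =
        (sum ns ℕₚ.≟ r)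
  ×-dec allUpTo? (λ j → (1 ℕₚ.≤? j) →-dec (sum (List.take j ns) ℕₚ.<? j)) i
  ×-dec allUpTo? (λ j → (i ℕₚ.≤? j) →-dec (sum (List.drop j ns) ℕₚ.≤? r ∸ j)) r
  where
  ns : List ℕ
  ns = toList v

-- All of {0, …, b}^k, each tuple once.
tuples : (b k : ℕ) → List (Vec ℕ k)
tuples b zero    = Vec.[] ∷ []
tuples b (suc k) = cartesianProductWith Vec._∷_ (upTo (suc b)) (tuples b k)

-- The entries of an admissible tuple are at most their total r, so summing
-- over {0, …, r}^r loses no terms.
C : (B : ℕ → ℚ) (i r : ℕ) → ℚ
C B i r =
  -1^ r * List.foldr _+_ 0ℚ
            (List.map term (List.filter (admissible? i r) (tuples r r)))
  where
  term : Vec ℕ r → ℚ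
  term v = Vec.foldr′ _*_ 1ℚ (Vec.map (λ n → B n * 1/ n !) v)

{-# OPTIONS --safe #-}

-- Write w_m = (-1)^m B_m / m!, so that sum w_m u^m = u / (e^u - 1) and hence
-- log (1 + x) = x sum_m w_m log^m (1 + x).  Comparing coefficients in this
-- identity times log^k (1 + x), the numbers [x^n] log^k (1 + x) satisfy the
-- recursion of the weighted paths from height k that reach 0 first at time n,
-- where a step m - 1 has weight w_m.
--
-- A tuple (n_1, ..., n_r) gives the path with steps n_j - 1.  Admissible tuples
-- are those whose path goes from 0 to some -k in i - 1 steps staying below 0, jumps to
-- some l >= 0 by a step of weight w_(k+l+1), and then descends to 0 without going below it.
-- The reversed first part is a first passage from k to 0 and the last part,
-- followed by a step -1, is one from l + 1 to 0.  So C_{i,r} is the coefficient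
-- of x^(i-1) y^(r-i+1) in sum_{k,l} w_(k+l+1) log^k (1 + x) log^(l+1) (1 + y).
-- Multiplying this series by x y (log (1 + x) - log (1 + y)) telescopes it, and shows
-- that it agrees with the defining fraction of G up to y log (1 + x).

module Submission where

open import Defs
open import Data.Nat.Base using (ℕ; _≤_; _+_; _∸_)
open import Data.Rational.Base using (ℚ)
open import Relation.Binary.PropositionalEquality.Core using (_≡_)

open import Algebra.Properties.CommutativeMonoid.Sum using (∑-distrib-+; ∑-comm)
open import Data.Fin.Base using (toℕ)
import Data.Integer.Base as ℤ
import Data.Integer.Properties as ℤₚ
open import Data.List.Base as List using (List; []; _∷_; _++_; applyUpTo; cartesianProductWith)
open import Data.List.Properties using (map-∘)
open import Data.Nat.Base as ℕ using (zero; suc; pred; _<_; _!; z≤n; s≤s; s≤s⁻¹; z<s)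
open import Data.Nat.Induction using (<-rec)
open import Data.Nat.ListAction using (sum)
import Data.Nat.Properties as ℕₚ
open import Data.Product.Base using (∃; _×_; _,_; proj₁)
open import Data.Rational.Base as ℚ using (0ℚ; 1ℚ)
import Data.Rational.Properties as ℚₚ
open import Data.Rational.Solver using (module +-*-Solver)
open import Data.Rational.Unnormalised.Base as ℚᵘ using (mkℚᵘ; *≡*)
import Data.Rational.Unnormalised.Properties as ℚᵘₚ
open import Data.Vec.Base as Vec using (Vec; []; _∷_; toList)
open import Function.Base using (_∘_)
open import Relation.Binary.PropositionalEquality
  using (refl; sym; trans; cong; cong₂; module ≡-Reasoning)
open import Relation.Nullary.Decidable.Core using (yes; no)
open import Relation.Nullary.Negation.Core using (¬_; contradiction)
open import Relation.Unary using (Decidable)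

open +-*-Solver using (solve; _:=_; _:+_; _:*_; _:-_; :-_; con)
open ≡-Reasoning

-- Truncated sums

∑<-cong : ∀ n {f g : ℕ → ℚ} → (∀ {k} → k < n → f k ≡ g k) → ∑< n f ≡ ∑< n g
∑<-cong zero    f≗g = refl
∑<-cong (suc n) f≗g = cong₂ ℚ._+_ (f≗g z<s) (∑<-cong n (f≗g ∘ s≤s))

∑<-zero : ∀ n {f : ℕ → ℚ} → (∀ {k} → k < n → f k ≡ 0ℚ) → ∑< n f ≡ 0ℚ
∑<-zero zero    f≗0 = refl
∑<-zero (suc n) f≗0 = cong₂ ℚ._+_ (f≗0 z<s) (∑<-zero n (f≗0 ∘ s≤s))

∑<-snoc : ∀ n (f : ℕ → ℚ) → ∑< (suc n) f ≡ ∑< n f ℚ.+ f n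
∑<-snoc zero    f = ℚₚ.+-comm (f 0) 0ℚ
∑<-snoc (suc n) f = begin
  f 0 ℚ.+ ∑< (suc n) (f ∘ suc)             ≡⟨ cong (f 0 ℚ.+_) (∑<-snoc n (f ∘ suc)) ⟩
  f 0 ℚ.+ (∑< n (f ∘ suc) ℚ.+ f (suc n))   ≡⟨ ℚₚ.+-assoc (f 0) _ _ ⟨
  ∑< (suc n) f ℚ.+ f (suc n)               ∎

∑<-extend : ∀ {n N} {f : ℕ → ℚ} → n ≤ N → (∀ {k} → n ≤ k → f k ≡ 0ℚ) → ∑< N f ≡ ∑< n f
∑<-extend {N = N} {f} z≤n f≗0 = ∑<-zero N {f} (λ _ → f≗0 z≤n)
∑<-extend {suc n} {suc N} {f} (s≤s n≤N) f≗0 = cong (f 0 ℚ.+_)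
    (∑<-extend {n} {N} {f ∘ suc} n≤N (λ n≤k → f≗0 (s≤s n≤k)))

∑<-+ : ∀ n (f g : ℕ → ℚ) → ∑< n (λ k → f k ℚ.+ g k) ≡ ∑< n f ℚ.+ ∑< n g
∑<-+ n f g = ∑-distrib-+ ℚₚ.+-0-commutativeMonoid (λ k → f (toℕ {n} k)) (λ k → g (toℕ {n} k))

∑<-*ˡ : ∀ n c (f : ℕ → ℚ) → c ℚ.* ∑< n f ≡ ∑< n (λ k → c ℚ.* f k)
∑<-*ˡ zero    c f = ℚₚ.*-zeroʳ c
∑<-*ˡ (suc n) c f = trans (ℚₚ.*-distribˡ-+ c (f 0) _) (cong (c ℚ.* f 0 ℚ.+_) (∑<-*ˡ n c (f ∘ suc)))

∑<-*ʳ : ∀ n c (f : ℕ → ℚ) → ∑< n f ℚ.* c ≡ ∑< n (λ k → f k ℚ.* c)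
∑<-*ʳ n c f = trans (ℚₚ.*-comm _ c) (trans (∑<-*ˡ n c f) (∑<-cong n (λ {k} _ → ℚₚ.*-comm c (f k))))

∑<-neg : ∀ n (f : ℕ → ℚ) → ∑< n (λ k → ℚ.- f k) ≡ ℚ.- ∑< n f
∑<-neg zero    f = refl
∑<-neg (suc n) f = trans (cong (ℚ.- f 0 ℚ.+_) (∑<-neg n (f ∘ suc))) (sym (ℚₚ.neg-distrib-+ (f 0) _))

∑<-- : ∀ n (f g : ℕ → ℚ) → ∑< n (λ k → f k ℚ.- g k) ≡ ∑< n f ℚ.- ∑< n g
∑<-- n f g = trans (∑<-+ n f (λ k → ℚ.- g k)) (cong (∑< n f ℚ.+_) (∑<-neg n g))

∑<-swap : ∀ m n (f : ℕ → ℕ → ℚ) → ∑< m (λ j → ∑< n (f j)) ≡ ∑< n (λ k → ∑< m (λ j → f j k))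
∑<-swap m n f = ∑-comm ℚₚ.+-0-commutativeMonoid {m} {n} (λ j k → f (toℕ {m} j) (toℕ {n} k))

∑<-last : ∀ n (f : ℕ → ℚ) → (∀ {k} → k < n → f k ≡ 0ℚ) → ∑< (suc n) f ≡ f n
∑<-last n f f≗0 = begin
  ∑< (suc n) f       ≡⟨ ∑<-snoc n f ⟩
  ∑< n f ℚ.+ f n     ≡⟨ cong (ℚ._+ f n) (∑<-zero n f≗0) ⟩
  0ℚ ℚ.+ f n         ≡⟨ ℚₚ.+-identityˡ (f n) ⟩
  f n                ∎

∑<-tail : ∀ n {f : ℕ → ℚ} → f n ≡ 0ℚ → ∑< n (f ∘ suc) ≡ ∑< n f ℚ.- f 0
∑<-tail n {f} fn≡0 = begin
  ∑< n (f ∘ suc)                           ≡⟨ solve 2 (λ a s → s := a :+ s :- a) refl (f 0) (∑< n (f ∘ suc)) ⟩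
  ∑< (suc n) f ℚ.- f 0                     ≡⟨ cong (ℚ._- f 0) (∑<-snoc n f) ⟩
  ∑< n f ℚ.+ f n ℚ.- f 0                   ≡⟨ cong (λ a → ∑< n f ℚ.+ a ℚ.- f 0) fn≡0 ⟩
  ∑< n f ℚ.+ 0ℚ ℚ.- f 0                    ≡⟨ cong (ℚ._- f 0) (ℚₚ.+-identityʳ (∑< n f)) ⟩
  ∑< n f ℚ.- f 0                           ∎

-- Regrouping along the antidiagonals k + l = s. The bound `M` is kept apart from `N` because the
-- induction peels off the row k = 0, which shortens the range of k but not that of l.
∑<-triangle : ∀ {N M} → N ≤ M → (a : ℕ → ℕ → ℚ) → (∀ {k l} → N ≤ k + l → a k l ≡ 0ℚ) →
              ∑< N (λ k → ∑< M (a k)) ≡ ∑< N (λ s → ∑< (suc s) λ k → a k (s ∸ k))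
∑<-triangle {zero}      _    a _   = refl
∑<-triangle {suc N} {M} N<M a a≗0 = begin
  ∑< M (a 0) ℚ.+ ∑< N (λ k → ∑< M (a (suc k)))
    ≡⟨ cong₂ ℚ._+_ (∑<-extend N<M a≗0) (∑<-triangle (ℕₚ.<⇒≤ N<M) (a ∘ suc) (a≗0 ∘ s≤s)) ⟩
  ∑< (suc N) (a 0) ℚ.+ T
    ≡⟨ cong (∑< (suc N) (a 0) ℚ.+_) (ℚₚ.+-identityˡ T) ⟨
  ∑< (suc N) (a 0) ℚ.+ ∑< (suc N) (λ s → ∑< s λ k → a (suc k) (s ∸ suc k))
    ≡⟨ ∑<-+ (suc N) (a 0) (λ s → ∑< s λ k → a (suc k) (s ∸ suc k)) ⟨
  ∑< (suc N) (λ s → ∑< (suc s) λ k → a k (s ∸ k)) ∎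
  where
  T : ℚ
  T = ∑< N (λ s → ∑< (suc s) λ k → a (suc k) (s ∸ k))

-- The substitution h = k + m. For h below m the truncated subtraction gives 0, where the first
-- hypothesis removes the term; the second removes the terms with k + m at least `N`.
∑<-shift : ∀ N m (A : ℕ → ℕ → ℚ) → (∀ h → A h 0 ≡ 0ℚ) → (∀ {h} → N ≤ h → A h (suc h ∸ m) ≡ 0ℚ) →
           ∑< N (λ k → A (k + m) (suc k)) ≡ ∑< N (λ h → A h (suc h ∸ m))
∑<-shift N zero    A A₀ A∞ = ∑<-cong N (λ {k} _ → cong (λ h → A h (suc k)) (ℕₚ.+-identityʳ k))
∑<-shift N (suc m) A A₀ A∞ = begin
  ∑< N (λ k → A (k + suc m) (suc k))          ≡⟨ ∑<-cong N (λ {k} _ → cong (λ h → A h (suc k)) (ℕₚ.+-suc k m)) ⟩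
  ∑< N (λ k → A (suc (k + m)) (suc k))        ≡⟨ ∑<-shift N m (A ∘ suc) (A₀ ∘ suc)
      (λ N≤h → A∞ (ℕₚ.m≤n⇒m≤1+n N≤h)) ⟩
  ∑< N (λ h → A (suc h) (suc h ∸ m))          ≡⟨ ∑<-tail N {λ h → A h (h ∸ m)} (A∞ ℕₚ.≤-refl) ⟩
  ∑< N (λ h → A h (h ∸ m)) ℚ.- A 0 (0 ∸ m)    ≡⟨ cong (λ x → ∑< N (λ h → A h (h ∸ m)) ℚ.- A 0 x) (ℕₚ.0∸n≡0 m) ⟩
  ∑< N (λ h → A h (h ∸ m)) ℚ.- A 0 0          ≡⟨ cong (λ x → ∑< N (λ h → A h (h ∸ m)) ℚ.- x) (A₀ 0) ⟩
  ∑< N (λ h → A h (h ∸ m)) ℚ.- 0ℚ             ≡⟨ ℚₚ.+-identityʳ _ ⟩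
  ∑< N (λ h → A h (h ∸ m))                    ∎

-- Powers of log (1 + x)

-- Defined by recursion so that `ι (suc n)` unfolds to `1ℚ ℚ.+ ι n`, a form which the ring solver
-- can use.
ι : ℕ → ℚ
ι zero    = 0ℚ
ι (suc n) = 1ℚ ℚ.+ ι n

ι-+ : ∀ m n → ι (m + n) ≡ ι m ℚ.+ ι n
ι-+ zero    n = sym (ℚₚ.+-identityˡ (ι n))
ι-+ (suc m) n = trans (cong (1ℚ ℚ.+_) (ι-+ m n)) (sym (ℚₚ.+-assoc 1ℚ (ι m) (ι n)))

ι-* : ∀ m n → ι (m ℕ.* n) ≡ ι m ℚ.* ι n
ι-* zero    n = sym (ℚₚ.*-zeroˡ (ι n))
ι-* (suc m) n = begin
  ι (n + m ℕ.* n)             ≡⟨ ι-+ n (m ℕ.* n) ⟩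
  ι n ℚ.+ ι (m ℕ.* n)         ≡⟨ cong (ι n ℚ.+_) (ι-* m n) ⟩
  ι n ℚ.+ ι m ℚ.* ι n         ≡⟨ solve 2 (λ m n → n :+ m :* n := (con 1ℚ :+ m) :* n) refl (ι m) (ι n) ⟩
  ι (suc m) ℚ.* ι n           ∎

toℚᵘ-ι : ∀ n → ℚ.toℚᵘ (ι n) ℚᵘ.≃ mkℚᵘ (ℤ.+ n) 0
toℚᵘ-ι zero    = *≡* refl
toℚᵘ-ι (suc n) = ℚᵘₚ.≃-trans (ℚₚ.toℚᵘ-homo-+ 1ℚ (ι n))
  (ℚᵘₚ.≃-trans (ℚᵘₚ.+-congʳ (ℚ.toℚᵘ 1ℚ) (toℚᵘ-ι n))
  (*≡* (cong (λ z → (ℤ.1ℤ ℤ.+ z) ℤ.* ℤ.1ℤ) (ℤₚ.*-identityʳ (ℤ.+ n)))))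

ι-inverse : ∀ n .{{_ : ℕ.NonZero n}} → ι n ℚ.* (ℤ.1ℤ ℚ./ n) ≡ 1ℚ
ι-inverse n@(suc d) = ℚₚ.toℚᵘ-injective (ℚᵘₚ.≃-trans (ℚₚ.toℚᵘ-homo-* (ι n) (ℤ.1ℤ ℚ./ n))
  (ℚᵘₚ.≃-trans (ℚᵘₚ.*-cong (toℚᵘ-ι n) (ℚₚ.toℚᵘ-fromℚᵘ (mkℚᵘ ℤ.1ℤ d)))
  (*≡* (trans (ℤₚ.*-identityʳ (ℤ.+ n ℤ.* ℤ.1ℤ)) (trans (ℤₚ.*-identityʳ (ℤ.+ n))
    (sym (trans (ℤₚ.*-identityˡ (ℤ.+ (1 ℕ.* n))) (cong ℤ.+_ (ℕₚ.*-identityˡ n)))))))))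

ι-cancelˡ : ∀ n {p q} → ι (suc n) ℚ.* p ≡ ι (suc n) ℚ.* q → p ≡ q
ι-cancelˡ n {p} {q} eq = begin
  p                           ≡⟨ insert p ⟩
  v ℚ.* (ι (suc n) ℚ.* p)     ≡⟨ cong (v ℚ.*_) eq ⟩
  v ℚ.* (ι (suc n) ℚ.* q)     ≡⟨ insert q ⟨
  q                           ∎
  where
  v : ℚ
  v = ℤ.1ℤ ℚ./ suc n
  insert : ∀ a → a ≡ v ℚ.* (ι (suc n) ℚ.* a)
  insert a = begin
    a                           ≡⟨ ℚₚ.*-identityˡ a ⟨
    1ℚ ℚ.* a                    ≡⟨ cong (ℚ._* a) (ι-inverse (suc n)) ⟨
    ι (suc n) ℚ.* v ℚ.* a       ≡⟨ solve 3 (λ i v a → i :* v :* a := v :* (i :* a)) refl (ι (suc n)) v a ⟩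
    v ℚ.* (ι (suc n) ℚ.* a)     ∎

1/!-suc : ∀ n → ι (suc n) ℚ.* 1/ suc n ! ≡ 1/ n !
1/!-suc n = begin
  i ℚ.* e                         ≡⟨ ℚₚ.*-identityʳ _ ⟨
  i ℚ.* e ℚ.* 1ℚ                  ≡⟨ cong (i ℚ.* e ℚ.*_) (ι-inverse (n !) {{n ℕₚ.!≢0}}) ⟨
  i ℚ.* e ℚ.* (ι (n !) ℚ.* d)     ≡⟨ solve 4 (λ i e f d → i :* e :* (f :* d) := i :* f :* e :* d)
      refl i e (ι (n !)) d ⟩
  i ℚ.* ι (n !) ℚ.* e ℚ.* d       ≡⟨ cong (λ a → a ℚ.* e ℚ.* d) (ι-* (suc n) (n !)) ⟨
  ι (suc n !) ℚ.* e ℚ.* d         ≡⟨ cong (ℚ._* d) (ι-inverse (suc n !) {{suc n ℕₚ.!≢0}}) ⟩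
  1ℚ ℚ.* d                        ≡⟨ ℚₚ.*-identityˡ d ⟩
  d                               ∎
  where
  i e d : ℚ
  i = ι (suc n)
  e = 1/ suc n !
  d = 1/ n !

-1^-+ : ∀ m n → -1^ (m + n) ≡ -1^ m ℚ.* -1^ n
-1^-+ zero    n = sym (ℚₚ.*-identityˡ _)
-1^-+ (suc m) n = trans (cong (ℚ.- 1ℚ ℚ.*_) (-1^-+ m n)) (sym (ℚₚ.*-assoc (ℚ.- 1ℚ) (-1^ m) (-1^ n)))

*₁-cong : ∀ {f f′ g g′} → f ≈₁ f′ → g ≈₁ g′ → f *₁ g ≈₁ f′ *₁ g′
*₁-cong f≈f′ g≈g′ n = ∑<-cong (suc n) (λ {k} _ → cong₂ ℚ._*_ (f≈f′ k) (g≈g′ (n ∸ k)))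

*₁-identityˡ : ∀ f → one *₁ f ≈₁ f
*₁-identityˡ f n = begin
  1ℚ ℚ.* f n ℚ.+ ∑< n (λ k → 0ℚ ℚ.* f (n ∸ suc k))   ≡⟨ cong₂ ℚ._+_ (ℚₚ.*-identityˡ (f n))
      (∑<-zero n {λ k → 0ℚ ℚ.* f (n ∸ suc k)} (λ {k} _ → ℚₚ.*-zeroˡ (f (n ∸ suc k)))) ⟩
  f n ℚ.+ 0ℚ                                         ≡⟨ ℚₚ.+-identityʳ (f n) ⟩
  f n                                                ∎

one-0< : ∀ {n} → 0 < n → one n ≡ 0ℚ
one-0< (s≤s _) = refl

*₁-identityʳ : ∀ f → f *₁ one ≈₁ f
*₁-identityʳ f n = begin
  (f *₁ one) n            ≡⟨ ∑<-last n (λ k → f k ℚ.* one (n ∸ k))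
      (λ {k} k<n → trans (cong (f k ℚ.*_) (one-0< (ℕₚ.m<n⇒0<n∸m k<n))) (ℚₚ.*-zeroʳ (f k))) ⟩
  f n ℚ.* one (n ∸ n)     ≡⟨ cong (λ a → f n ℚ.* one a) (ℕₚ.n∸n≡0 n) ⟩
  f n ℚ.* 1ℚ              ≡⟨ ℚₚ.*-identityʳ (f n) ⟩
  f n                     ∎

*₁-+ˡ : ∀ f g h n → ((λ k → f k ℚ.+ g k) *₁ h) n ≡ (f *₁ h) n ℚ.+ (g *₁ h) n
*₁-+ˡ f g h n = trans
  (∑<-cong (suc n) (λ {k} _ → ℚₚ.*-distribʳ-+ (h (n ∸ k)) (f k) (g k)))
  (∑<-+ (suc n) (λ k → f k ℚ.* h (n ∸ k)) (λ k → g k ℚ.* h (n ∸ k)))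

*₁-+ʳ : ∀ f g h n → (f *₁ (λ k → g k ℚ.+ h k)) n ≡ (f *₁ g) n ℚ.+ (f *₁ h) n
*₁-+ʳ f g h n = trans
  (∑<-cong (suc n) (λ {k} _ → ℚₚ.*-distribˡ-+ (f k) (g (n ∸ k)) (h (n ∸ k))))
  (∑<-+ (suc n) (λ k → f k ℚ.* g (n ∸ k)) (λ k → f k ℚ.* h (n ∸ k)))

-- θ = x d/dx, ∂ = d/dx and D = (1 + x) d/dx.
θ ∂ D : Series → Series
θ f n = ι n ℚ.* f n
∂ f n = θ f (suc n)
D f n = ∂ f n ℚ.+ θ f n

θ-*₁ : ∀ f g n → θ (f *₁ g) n ≡ (θ f *₁ g) n ℚ.+ (f *₁ θ g) n
θ-*₁ f g n = begin
  ι n ℚ.* (f *₁ g) n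
    ≡⟨ ∑<-*ˡ (suc n) (ι n) (λ k → f k ℚ.* g (n ∸ k)) ⟩
  ∑< (suc n) (λ k → ι n ℚ.* (f k ℚ.* g (n ∸ k)))
    ≡⟨ ∑<-cong (suc n) (λ {k} k≤n → split k (s≤s⁻¹ k≤n)) ⟩
  ∑< (suc n) (λ k → θ f k ℚ.* g (n ∸ k) ℚ.+ f k ℚ.* θ g (n ∸ k))
    ≡⟨ ∑<-+ (suc n) (λ k → θ f k ℚ.* g (n ∸ k)) (λ k → f k ℚ.* θ g (n ∸ k)) ⟩
  (θ f *₁ g) n ℚ.+ (f *₁ θ g) n ∎
  where
  split : ∀ k → k ≤ n → ι n ℚ.* (f k ℚ.* g (n ∸ k)) ≡ θ f k ℚ.* g (n ∸ k) ℚ.+ f k ℚ.* θ g (n ∸ k)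
  split k k≤n = begin
    ι n ℚ.* (f k ℚ.* g (n ∸ k))
      ≡⟨ cong (λ m → ι m ℚ.* (f k ℚ.* g (n ∸ k))) (ℕₚ.m+[n∸m]≡n k≤n) ⟨
    ι (k + (n ∸ k)) ℚ.* (f k ℚ.* g (n ∸ k))
      ≡⟨ cong (ℚ._* (f k ℚ.* g (n ∸ k))) (ι-+ k (n ∸ k)) ⟩
    (ι k ℚ.+ ι (n ∸ k)) ℚ.* (f k ℚ.* g (n ∸ k))
      ≡⟨ solve 4 (λ i j f g → (i :+ j) :* (f :* g) := i :* f :* g :+ f :* (j :* g))
          refl (ι k) (ι (n ∸ k)) (f k) (g (n ∸ k)) ⟩
    θ f k ℚ.* g (n ∸ k) ℚ.+ f k ℚ.* θ g (n ∸ k) ∎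

-- This is `θ-*₁` in degree n + 1; the boundary terms vanish because `θ` kills constant terms.
∂-*₁ : ∀ f g n → ∂ (f *₁ g) n ≡ (∂ f *₁ g) n ℚ.+ (f *₁ ∂ g) n
∂-*₁ f g n = trans (θ-*₁ f g (suc n)) (cong₂ ℚ._+_ left right)
  where
  left : (θ f *₁ g) (suc n) ≡ (∂ f *₁ g) n
  left = begin
    0ℚ ℚ.* f 0 ℚ.* g (suc n) ℚ.+ (∂ f *₁ g) n     ≡⟨ solve 3 (λ a b c → con 0ℚ :* a :* b :+ c := c)
        refl (f 0) (g (suc n)) ((∂ f *₁ g) n) ⟩
    (∂ f *₁ g) n                                  ∎
  right : (f *₁ θ g) (suc n) ≡ (f *₁ ∂ g) n
  right = begin
    (f *₁ θ g) (suc n)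
      ≡⟨ ∑<-snoc (suc n) (λ k → f k ℚ.* θ g (suc n ∸ k)) ⟩
    ∑< (suc n) (λ k → f k ℚ.* θ g (suc n ∸ k)) ℚ.+ f (suc n) ℚ.* θ g (n ∸ n)
      ≡⟨ cong₂ ℚ._+_
           (∑<-cong (suc n) (λ {k} k≤n → cong (λ m → f k ℚ.* θ g m) (ℕₚ.+-∸-assoc 1 (s≤s⁻¹ k≤n))))
           (cong (λ m → f (suc n) ℚ.* θ g m) (ℕₚ.n∸n≡0 n)) ⟩
    (f *₁ ∂ g) n ℚ.+ f (suc n) ℚ.* (0ℚ ℚ.* g 0)
      ≡⟨ solve 3 (λ a b c → c :+ b :* (con 0ℚ :* a) := c) refl (g 0) (f (suc n)) ((f *₁ ∂ g) n) ⟩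
    (f *₁ ∂ g) n ∎

D-*₁ : ∀ f g n → D (f *₁ g) n ≡ (D f *₁ g) n ℚ.+ (f *₁ D g) n
D-*₁ f g n = begin
  ∂ (f *₁ g) n ℚ.+ θ (f *₁ g) n
    ≡⟨ cong₂ ℚ._+_ (∂-*₁ f g n) (θ-*₁ f g n) ⟩
  (∂ f *₁ g) n ℚ.+ (f *₁ ∂ g) n ℚ.+ ((θ f *₁ g) n ℚ.+ (f *₁ θ g) n)
    ≡⟨ solve 4 (λ a b c d → a :+ b :+ (c :+ d) := a :+ c :+ (b :+ d))
        refl ((∂ f *₁ g) n) ((f *₁ ∂ g) n) ((θ f *₁ g) n) ((f *₁ θ g) n) ⟩
  (∂ f *₁ g) n ℚ.+ (θ f *₁ g) n ℚ.+ ((f *₁ ∂ g) n ℚ.+ (f *₁ θ g) n)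
    ≡⟨ cong₂ ℚ._+_ (*₁-+ˡ (∂ f) (θ f) g n) (*₁-+ʳ f (∂ g) (θ g) n) ⟨
  (D f *₁ g) n ℚ.+ (f *₁ D g) n ∎

log^ : ℕ → Series
log^ zero    = one
log^ (suc k) = log^ k *₁ log1+

log^-1 : log^ 1 ≈₁ log1+
log^-1 = *₁-identityˡ log1+

-- As log (1 + x) has no constant term, its k-th power starts in degree k. This makes all sums over
-- powers of the logarithm finite in each degree.
log^-< : ∀ {k n} → n < k → log^ k n ≡ 0ℚ
log^-< {suc k} {n} n<k = begin
  log^ (suc k) n              ≡⟨ ∑<-last n (λ j → log^ k j ℚ.* log1+ (n ∸ j))
      (λ {j} j<n → trans (cong (ℚ._* log1+ (n ∸ j)) (log^-< (ℕₚ.<-≤-trans j<n (s≤s⁻¹ n<k))))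
          (ℚₚ.*-zeroˡ (log1+ (n ∸ j)))) ⟩
  log^ k n ℚ.* log1+ (n ∸ n)  ≡⟨ cong (λ m → log^ k n ℚ.* log1+ m) (ℕₚ.n∸n≡0 n) ⟩
  log^ k n ℚ.* 0ℚ             ≡⟨ ℚₚ.*-zeroʳ (log^ k n) ⟩
  0ℚ                          ∎

∂-log1+ : ∀ n → ∂ log1+ n ≡ -1^ n
∂-log1+ n = begin
  ι (suc n) ℚ.* (-1^ n ℚ.* (ℤ.1ℤ ℚ./ suc n))     ≡⟨ solve 3 (λ i s v → i :* (s :* v) := s :* (i :* v))
      refl (ι (suc n)) (-1^ n) (ℤ.1ℤ ℚ./ suc n) ⟩
  -1^ n ℚ.* (ι (suc n) ℚ.* (ℤ.1ℤ ℚ./ suc n))     ≡⟨ cong (-1^ n ℚ.*_) (ι-inverse (suc n)) ⟩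
  -1^ n ℚ.* 1ℚ                                   ≡⟨ ℚₚ.*-identityʳ _ ⟩
  -1^ n                                          ∎

-- The reason for using `D`: it acts on series in u = log (1 + x) as d/du.
D-log1+ : D log1+ ≈₁ one
D-log1+ zero    = refl
D-log1+ (suc n) = begin
  ∂ log1+ (suc n) ℚ.+ ∂ log1+ n        ≡⟨ cong₂ ℚ._+_ (∂-log1+ (suc n)) (∂-log1+ n) ⟩
  ℚ.- 1ℚ ℚ.* -1^ n ℚ.+ -1^ n           ≡⟨ solve 1 (λ s → (:- con 1ℚ) :* s :+ s := con 0ℚ) refl (-1^ n) ⟩
  0ℚ                                   ∎

-- For k = 0 the factor `ι k` is 0, so the value of `pred 0` does not matter.
D-log^ : ∀ k n → D (log^ k) n ≡ ι k ℚ.* log^ (pred k) n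
D-log^ zero zero    = refl
D-log^ zero (suc n) = solve 2 (λ a b → a :* con 0ℚ :+ b :* con 0ℚ := con 0ℚ :* con 0ℚ)
    refl (ι (suc (suc n))) (ι (suc n))
D-log^ (suc k) n = begin
  D (log^ k *₁ log1+) n
    ≡⟨ D-*₁ (log^ k) log1+ n ⟩
  (D (log^ k) *₁ log1+) n ℚ.+ (log^ k *₁ D log1+) n
    ≡⟨ cong₂ ℚ._+_ (power k) (trans (*₁-cong {log^ k} (λ _ → refl) D-log1+ n) (*₁-identityʳ (log^ k) n)) ⟩
  ι k ℚ.* log^ k n ℚ.+ log^ k n
    ≡⟨ solve 2 (λ i l → i :* l :+ l := (con 1ℚ :+ i) :* l) refl (ι k) (log^ k n) ⟩
  ι (suc k) ℚ.* log^ k n ∎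
  where
  power : ∀ k → (D (log^ k) *₁ log1+) n ≡ ι k ℚ.* log^ k n
  power k = begin
    (D (log^ k) *₁ log1+) n
      ≡⟨ ∑<-cong (suc n) (λ {j} _ → trans (cong (ℚ._* log1+ (n ∸ j)) (D-log^ k j))
          (ℚₚ.*-assoc (ι k) (log^ (pred k) j) (log1+ (n ∸ j)))) ⟩
    ∑< (suc n) (λ j → ι k ℚ.* (log^ (pred k) j ℚ.* log1+ (n ∸ j)))
      ≡⟨ ∑<-*ˡ (suc n) (ι k) (λ j → log^ (pred k) j ℚ.* log1+ (n ∸ j)) ⟨
    ι k ℚ.* (log^ (pred k) *₁ log1+) n
      ≡⟨ absorb k ⟩
    ι k ℚ.* log^ k n ∎
    where
    absorb : ∀ k → ι k ℚ.* (log^ (pred k) *₁ log1+) n ≡ ι k ℚ.* log^ k n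
    absorb zero    = trans (ℚₚ.*-zeroˡ ((one *₁ log1+) n)) (sym (ℚₚ.*-zeroˡ (one n)))
    absorb (suc k) = refl

-- The series e^(-u) at u = log (1 + x)

exp⁻ : Series
exp⁻ n = -1^ n ℚ.* 1/ n !

θ-exp⁻ : ∀ n → θ exp⁻ (suc n) ≡ ℚ.- exp⁻ n
θ-exp⁻ n = begin
  ι (suc n) ℚ.* (ℚ.- 1ℚ ℚ.* -1^ n ℚ.* 1/ suc n !)     ≡⟨ solve 3
      (λ i s e → i :* ((:- con 1ℚ) :* s :* e) := :- (s :* (i :* e))) refl (ι (suc n)) (-1^ n) (1/ suc n !) ⟩
  ℚ.- (-1^ n ℚ.* (ι (suc n) ℚ.* 1/ suc n !))          ≡⟨ cong (λ e → ℚ.- (-1^ n ℚ.* e)) (1/!-suc n) ⟩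
  ℚ.- exp⁻ n                                          ∎

-- The coefficient of x^n in log^k (1 + x) f (log (1 + x)), when n < N.
infix 9 _∘log[_]
_∘log[_] : Series → ℕ → ℕ → Series
(f ∘log[ N ]) k n = ∑< N λ j → f j ℚ.* log^ (k + j) n

log^-≥ : ∀ {N} k {n} c → n < N → c ℚ.* log^ (k + N) n ≡ 0ℚ
log^-≥ {N} k {n} c n<N = trans (cong (c ℚ.*_) (log^-< (ℕₚ.<-≤-trans n<N (ℕₚ.m≤n+m N k)))) (ℚₚ.*-zeroʳ c)

∘log-0 : ∀ f {N} k → 0 < N → (f ∘log[ N ]) k 0 ≡ f 0 ℚ.* log^ k 0
∘log-0 f {suc N} k _ = begin
  f 0 ℚ.* log^ (k + 0) 0 ℚ.+ ∑< N (λ j → f (suc j) ℚ.* log^ (k + suc j) 0)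
    ≡⟨ cong₂ (λ m a → f 0 ℚ.* log^ m 0 ℚ.+ a) (ℕₚ.+-identityʳ k)
        (∑<-zero N {λ j → f (suc j) ℚ.* log^ (k + suc j) 0} (λ {j} _ → log^-≥ k (f (suc j)) z<s)) ⟩
  f 0 ℚ.* log^ k 0 ℚ.+ 0ℚ
    ≡⟨ ℚₚ.+-identityʳ _ ⟩
  f 0 ℚ.* log^ k 0 ∎

module _ {N : ℕ} where

  -- Up to truncation, `E k` is log^k (1 + x) / (1 + x), as `[1+x]E` shows.
  E : ℕ → Series
  E = exp⁻ ∘log[ N ]

  -- This is d/du (u^k e^(-u)) = k u^(k-1) e^(-u) - u^k e^(-u) at u = log (1 + x); `spread` divides
  -- the exponent k + j between the two summands. Differentiation lowers exponents by one, so the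
  -- truncation at `N` is harmless when n + 1 < `N`.
  D-E : ∀ k {n} → suc n < N → D (E k) n ≡ ι k ℚ.* E (pred k) n ℚ.- E k n
  D-E k {n} n<N = begin
    ι (suc n) ℚ.* E k (suc n) ℚ.+ ι n ℚ.* E k n
      ≡⟨ cong₂ ℚ._+_ (∑<-*ˡ N (ι (suc n)) (λ j → exp⁻ j ℚ.* log^ (k + j) (suc n)))
          (∑<-*ˡ N (ι n) (λ j → exp⁻ j ℚ.* log^ (k + j) n)) ⟩
    ∑< N (λ j → ι (suc n) ℚ.* (exp⁻ j ℚ.* log^ (k + j) (suc n))) ℚ.+ ∑< N
        (λ j → ι n ℚ.* (exp⁻ j ℚ.* log^ (k + j) n))
      ≡⟨ ∑<-+ N (λ j → ι (suc n) ℚ.* (exp⁻ j ℚ.* log^ (k + j) (suc n)))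
          (λ j → ι n ℚ.* (exp⁻ j ℚ.* log^ (k + j) n)) ⟨
    ∑< N (λ j → ι (suc n) ℚ.* (exp⁻ j ℚ.* log^ (k + j) (suc n)) ℚ.+ ι n ℚ.* (exp⁻ j ℚ.* log^ (k + j) n))
      ≡⟨ ∑<-cong N (λ {j} _ → term j) ⟩
    ∑< N (λ j → ι k ℚ.* (exp⁻ j ℚ.* log^ (pred k + j) n) ℚ.+ θ exp⁻ j ℚ.* log^ (pred (k + j)) n)
      ≡⟨ ∑<-+ N (λ j → ι k ℚ.* (exp⁻ j ℚ.* log^ (pred k + j) n)) (λ j → θ exp⁻ j ℚ.* log^ (pred (k + j)) n) ⟩
    ∑< N (λ j → ι k ℚ.* (exp⁻ j ℚ.* log^ (pred k + j) n)) ℚ.+ ∑< N (λ j → θ exp⁻ j ℚ.* log^ (pred (k + j)) n)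
      ≡⟨ cong₂ ℚ._+_ (sym (∑<-*ˡ N (ι k) (λ j → exp⁻ j ℚ.* log^ (pred k + j) n))) derivative ⟩
    ι k ℚ.* E (pred k) n ℚ.- E k n ∎
    where
    spread : ∀ k j → ι (k + j) ℚ.* log^ (pred (k + j)) n ≡ ι k ℚ.* log^ (pred k + j) n ℚ.+ ι j ℚ.* log^
        (pred (k + j)) n
    spread zero    j = solve 3 (λ a b c → a :* b := con 0ℚ :* c :+ a :* b) refl (ι j) (log^ (pred j) n) (log^ j n)
    spread (suc k) j = trans (cong (ℚ._* log^ (k + j) n) (ι-+ (suc k) j))
        (ℚₚ.*-distribʳ-+ (log^ (k + j) n) (ι (suc k)) (ι j))

    term : ∀ j → ι (suc n) ℚ.* (exp⁻ j ℚ.* log^ (k + j) (suc n)) ℚ.+ ι n ℚ.* (exp⁻ j ℚ.* log^ (k + j) n)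
               ≡ ι k ℚ.* (exp⁻ j ℚ.* log^ (pred k + j) n) ℚ.+ θ exp⁻ j ℚ.* log^ (pred (k + j)) n
    term j = begin
      ι (suc n) ℚ.* (e ℚ.* log^ (k + j) (suc n)) ℚ.+ ι n ℚ.* (e ℚ.* log^ (k + j) n)
        ≡⟨ solve 5 (λ e i i′ l l′ → i :* (e :* l) :+ i′ :* (e :* l′) := e :* (i :* l :+ i′ :* l′))
            refl e (ι (suc n)) (ι n) (log^ (k + j) (suc n)) (log^ (k + j) n) ⟩
      e ℚ.* D (log^ (k + j)) n
        ≡⟨ cong (e ℚ.*_) (trans (D-log^ (k + j) n) (spread k j)) ⟩
      e ℚ.* (ι k ℚ.* log^ (pred k + j) n ℚ.+ ι j ℚ.* log^ (pred (k + j)) n)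
        ≡⟨ solve 5 (λ e i i′ l l′ → e :* (i :* l :+ i′ :* l′) := i :* (e :* l) :+ i′ :* e :* l′)
            refl e (ι k) (ι j) (log^ (pred k + j) n) (log^ (pred (k + j)) n) ⟩
      ι k ℚ.* (e ℚ.* log^ (pred k + j) n) ℚ.+ ι j ℚ.* e ℚ.* log^ (pred (k + j)) n ∎
      where
      e : ℚ
      e = exp⁻ j

    derivative : ∑< N (λ j → θ exp⁻ j ℚ.* log^ (pred (k + j)) n) ≡ ℚ.- E k n
    derivative = begin
      ∑< N f
        ≡⟨ solve 2 (λ s l → s := s :- con 0ℚ :* l) refl (∑< N f) (log^ (pred (k + 0)) n) ⟩
      ∑< N f ℚ.- f 0
        ≡⟨ ∑<-tail N {f} top ⟨
      ∑< N (f ∘ suc)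
        ≡⟨ ∑<-cong N (λ {j} _ → next j) ⟩
      ∑< N (λ j → ℚ.- (exp⁻ j ℚ.* log^ (k + j) n))
        ≡⟨ ∑<-neg N (λ j → exp⁻ j ℚ.* log^ (k + j) n) ⟩
      ℚ.- E k n ∎
      where
      f : ℕ → ℚ
      f j = θ exp⁻ j ℚ.* log^ (pred (k + j)) n
      top : f N ≡ 0ℚ
      top = trans (cong (θ exp⁻ N ℚ.*_) (log^-< (ℕₚ.pred-mono-≤ (ℕₚ.≤-trans n<N (ℕₚ.m≤n+m N k)))))
          (ℚₚ.*-zeroʳ (θ exp⁻ N))
      next : ∀ j → f (suc j) ≡ ℚ.- (exp⁻ j ℚ.* log^ (k + j) n)
      next j = trans
        (cong₂ ℚ._*_ (θ-exp⁻ j) (cong (λ m → log^ (pred m) n) (ℕₚ.+-suc k j)))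
        (sym (ℚₚ.neg-distribˡ-* (exp⁻ j) (log^ (k + j) n)))

  -- The left side is the coefficient of x^n in d/dx ((1 + x) `E k`), which is `D (E k)` plus `E k`;
  -- the added `E k` cancels the last summand of `D-E`.
  D-E′ : ∀ k {n} → suc n < N → ι (suc n) ℚ.* (E k (suc n) ℚ.+ E k n) ≡ ι k ℚ.* E (pred k) n
  D-E′ k {n} n<N = begin
    ι (suc n) ℚ.* (E k (suc n) ℚ.+ E k n)
      ≡⟨ solve 3 (λ i e e′ → (con 1ℚ :+ i) :* (e :+ e′) := (con 1ℚ :+ i) :* e :+ i :* e′ :+ e′)
          refl (ι n) (E k (suc n)) (E k n) ⟩
    D (E k) n ℚ.+ E k n
      ≡⟨ cong (ℚ._+ E k n) (D-E k n<N) ⟩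
    ι k ℚ.* E (pred k) n ℚ.- E k n ℚ.+ E k n
      ≡⟨ solve 2 (λ a b → a :- b :+ b := a) refl (ι k ℚ.* E (pred k) n) (E k n) ⟩
    ι k ℚ.* E (pred k) n ∎

  -- (1 + x) e^(-log (1 + x)) = 1: both sides, times log^k, satisfy the same
  -- differential equation in x.
  [1+x]E : ∀ k {n} → suc n < N → E k (suc n) ℚ.+ E k n ≡ log^ k (suc n)
  [1+x]E k {n} n<N = ι-cancelˡ n (begin
    ι (suc n) ℚ.* (E k (suc n) ℚ.+ E k n)                           ≡⟨ D-E′ k n<N ⟩
    ι k ℚ.* E (pred k) n                                            ≡⟨ step n n<N ⟩
    ι k ℚ.* log^ (pred k) n ℚ.- ι n ℚ.* log^ k n                    ≡⟨ cong (ℚ._- ι n ℚ.* log^ k n) (D-log^ k n) ⟨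
    D (log^ k) n ℚ.- ι n ℚ.* log^ k n                               ≡⟨ solve 2 (λ a b → a :+ b :- b := a)
        refl (∂ (log^ k) n) (θ (log^ k) n) ⟩
    ι (suc n) ℚ.* log^ k (suc n)                                    ∎)
    where
    -- Induction on the degree: for n + 1, `[1+x]E` is used in degree n both for `pred k` and for k,
    -- linked by `D-E′`.
    step : ∀ n → suc n < N → ι k ℚ.* E (pred k) n ≡ ι k ℚ.* log^ (pred k) n ℚ.- ι n ℚ.* log^ k n
    step zero 1<N = begin
      ι k ℚ.* E (pred k) 0
        ≡⟨ cong (ι k ℚ.*_) (∘log-0 exp⁻ (pred k) (ℕₚ.<-trans z<s 1<N)) ⟩
      ι k ℚ.* (1ℚ ℚ.* log^ (pred k) 0)
        ≡⟨ solve 3 (λ a b c → a :* (con 1ℚ :* b) := a :* b :- con 0ℚ :* c)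
            refl (ι k) (log^ (pred k) 0) (log^ k 0) ⟩
      ι k ℚ.* log^ (pred k) 0 ℚ.- 0ℚ ℚ.* log^ k 0 ∎
    step (suc n) n<N = begin
      ι k ℚ.* E (pred k) (suc n)
        ≡⟨ solve 3 (λ i e e′ → i :* e := i :* (e :+ e′) :- i :* e′)
            refl (ι k) (E (pred k) (suc n)) (E (pred k) n) ⟩
      ι k ℚ.* (E (pred k) (suc n) ℚ.+ E (pred k) n) ℚ.- ι k ℚ.* E (pred k) n
        ≡⟨ cong₂ (λ a b → ι k ℚ.* a ℚ.- b) ([1+x]E (pred k) n<N′) (sym (D-E′ k n<N′)) ⟩
      ι k ℚ.* log^ (pred k) (suc n) ℚ.- ι (suc n) ℚ.* (E k (suc n) ℚ.+ E k n)
        ≡⟨ cong (λ a → ι k ℚ.* log^ (pred k) (suc n) ℚ.- ι (suc n) ℚ.* a) ([1+x]E k n<N′) ⟩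
      ι k ℚ.* log^ (pred k) (suc n) ℚ.- ι (suc n) ℚ.* log^ k (suc n) ∎
      where
      n<N′ : suc n < N
      n<N′ = ℕₚ.<-trans ℕₚ.≤-refl n<N

-- The equation defining G

∑-*₁ : ∀ N (F : ℕ → Series) h n → ((λ j → ∑< N λ k → F k j) *₁ h) n ≡ ∑< N λ k → (F k *₁ h) n
∑-*₁ N F h n = trans
  (∑<-cong (suc n) (λ {j} _ → ∑<-*ʳ N (h (n ∸ j)) (λ k → F k j)))
  (∑<-swap (suc n) N (λ j k → F k j ℚ.* h (n ∸ j)))

scale-*₁ : ∀ c f h n → ((λ j → c ℚ.* f j) *₁ h) n ≡ c ℚ.* (f *₁ h) n
scale-*₁ c f h n = trans
  (∑<-cong (suc n) (λ {j} _ → ℚₚ.*-assoc c (f j) (h (n ∸ j))))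
  (sym (∑<-*ˡ (suc n) c (λ j → f j ℚ.* h (n ∸ j))))

var-suc : ∀ n → var (suc n) ≡ one n
var-suc zero    = refl
var-suc (suc n) = refl

inX-0< : ∀ f m {n} → 0 < n → inX f m n ≡ 0ℚ
inX-0< f m (s≤s _) = refl

inY-0< : ∀ f {m} n → 0 < m → inY f m n ≡ 0ℚ
inY-0< f n (s≤s _) = refl

-- Only the powers of x occur in `inX f`, so the inner sum keeps the single index l = n and a
-- one-variable Cauchy product remains.
*₂-inX : ∀ F f m n → (F *₂ inX f) m n ≡ ((λ k → F k n) *₁ f) m
*₂-inX F f m n = ∑<-cong (suc m) λ {k} _ → begin
  ∑< (suc n) (λ l → F k l ℚ.* inX f (m ∸ k) (n ∸ l))
    ≡⟨ ∑<-last n (λ l → F k l ℚ.* inX f (m ∸ k) (n ∸ l))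
        (λ {l} l<n → trans (cong (F k l ℚ.*_) (inX-0< f (m ∸ k) (ℕₚ.m<n⇒0<n∸m l<n))) (ℚₚ.*-zeroʳ (F k l))) ⟩
  F k n ℚ.* inX f (m ∸ k) (n ∸ n)
    ≡⟨ cong (λ z → F k n ℚ.* inX f (m ∸ k) z) (ℕₚ.n∸n≡0 n) ⟩
  F k n ℚ.* f (m ∸ k) ∎

*₂-inY : ∀ F f m n → (F *₂ inY f) m n ≡ (F m *₁ f) n
*₂-inY F f m n = begin
  (F *₂ inY f) m n
    ≡⟨ ∑<-last m (λ k → ∑< (suc n) λ l → F k l ℚ.* inY f (m ∸ k) (n ∸ l)) (λ {k} k<m → ∑<-zero (suc n) (λ {l} _ →
         trans (cong (F k l ℚ.*_) (inY-0< f (n ∸ l) (ℕₚ.m<n⇒0<n∸m k<m))) (ℚₚ.*-zeroʳ (F k l)))) ⟩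
  ∑< (suc n) (λ l → F m l ℚ.* inY f (m ∸ m) (n ∸ l))
    ≡⟨ cong (λ z → ∑< (suc n) (λ l → F m l ℚ.* inY f z (n ∸ l))) (ℕₚ.n∸n≡0 m) ⟩
  (F m *₁ f) n ∎

*₂-congʳ : ∀ F {G H} → G ≈₂ H → F *₂ G ≈₂ F *₂ H
*₂-congʳ F G≈H m n = ∑<-cong (suc m) λ {k} _ → ∑<-cong (suc n) λ {l} _ → cong (F k l ℚ.*_) (G≈H (m ∸ k) (n ∸ l))

*₂--ʳ : ∀ F G H m n → (F *₂ (G -₂ H)) m n ≡ (F *₂ G) m n ℚ.- (F *₂ H) m n
*₂--ʳ F G H m n = trans
  (∑<-cong (suc m) λ {k} _ → trans
    (∑<-cong (suc n) λ {l} _ → solve 3 (λ f g h → f :* (g :- h) := f :* g :- f :* h)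
        refl (F k l) (G (m ∸ k) (n ∸ l)) (H (m ∸ k) (n ∸ l)))
    (∑<-- (suc n) (λ l → F k l ℚ.* G (m ∸ k) (n ∸ l)) (λ l → F k l ℚ.* H (m ∸ k) (n ∸ l))))
  (∑<-- (suc m) (λ k → ∑< (suc n) λ l → F k l ℚ.* G (m ∸ k) (n ∸ l))
      (λ k → ∑< (suc n) λ l → F k l ℚ.* H (m ∸ k) (n ∸ l)))

*₁-zeroˡ : ∀ {f} g n → (∀ k → f k ≡ 0ℚ) → (f *₁ g) n ≡ 0ℚ
*₁-zeroˡ {f} g n f≗0 = ∑<-zero (suc n) {λ k → f k ℚ.* g (n ∸ k)}
    (λ {k} _ → trans (cong (ℚ._* g (n ∸ k)) (f≗0 k)) (ℚₚ.*-zeroˡ (g (n ∸ k))))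

inX-*₂ : ∀ f g → inX f *₂ inX g ≈₂ inX (f *₁ g)
inX-*₂ f g m zero    = *₂-inX (inX f) g m 0
inX-*₂ f g m (suc n) = trans (*₂-inX (inX f) g m (suc n)) (*₁-zeroˡ g m (λ _ → refl))

inY-*₂ : ∀ f g → inY f *₂ inY g ≈₂ inY (f *₁ g)
inY-*₂ f g zero    n = *₂-inY (inY f) g 0 n
inY-*₂ f g (suc m) n = trans (*₂-inY (inY f) g (suc m) n) (*₁-zeroˡ g n (λ _ → refl))

inY-*₂-inX : ∀ f g m n → (inY f *₂ inX g) m n ≡ f n ℚ.* g m
inY-*₂-inX f g m n = begin
  (inY f *₂ inX g) m n
    ≡⟨ *₂-inX (inY f) g m n ⟩
  f n ℚ.* g m ℚ.+ ∑< m (λ k → 0ℚ ℚ.* g (m ∸ suc k))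
    ≡⟨ cong (f n ℚ.* g m ℚ.+_) (∑<-zero m {λ k → 0ℚ ℚ.* g (m ∸ suc k)} (λ {k} _ → ℚₚ.*-zeroˡ (g (m ∸ suc k)))) ⟩
  f n ℚ.* g m ℚ.+ 0ℚ
    ≡⟨ ℚₚ.+-identityʳ _ ⟩
  f n ℚ.* g m ∎

inX-*₂-inY : ∀ f g m n → (inX f *₂ inY g) m n ≡ f m ℚ.* g n
inX-*₂-inY f g m n = begin
  (inX f *₂ inY g) m n
    ≡⟨ *₂-inY (inX f) g m n ⟩
  f m ℚ.* g n ℚ.+ ∑< n (λ k → 0ℚ ℚ.* g (n ∸ suc k))
    ≡⟨ cong (f m ℚ.* g n ℚ.+_) (∑<-zero n {λ k → 0ℚ ℚ.* g (n ∸ suc k)} (λ {k} _ → ℚₚ.*-zeroˡ (g (n ∸ suc k)))) ⟩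
  f m ℚ.* g n ℚ.+ 0ℚ
    ≡⟨ ℚₚ.+-identityʳ _ ⟩
  f m ℚ.* g n ∎

log1+² : Series
log1+² = log1+ *₁ log1+

-- The coefficient of x^(m+1) y^n in the equation defining G.
GregoryAt : Series₂ → ℕ → ℕ → Set
GregoryAt F m n =
    ((λ k → F k n) *₁ log1+) (suc m) ℚ.- (F (suc m) *₁ log1+) n
  ≡ var n ℚ.* log1+² (suc m) ℚ.- one m ℚ.* log1+² n

gregoryAt : ∀ {G} → IsGregory G → ∀ m n → GregoryAt G m n
gregoryAt {G} gregory m n = begin
  ((λ k → G k n) *₁ log1+) (suc m) ℚ.- (G (suc m) *₁ log1+) n
    ≡⟨ cong₂ ℚ._-_ (*₂-inX G log1+ (suc m) n) (*₂-inY G log1+ (suc m) n) ⟨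
  (G *₂ inX log1+) (suc m) n ℚ.- (G *₂ inY log1+) (suc m) n
    ≡⟨ *₂--ʳ G (inX log1+) (inY log1+) (suc m) n ⟨
  (G *₂ (inX log1+ -₂ inY log1+)) (suc m) n
    ≡⟨ gregory (suc m) n ⟩
  (inY var *₂ (inX log1+ *₂ inX log1+)) (suc m) n ℚ.- (inX var *₂ (inY log1+ *₂ inY log1+)) (suc m) n
    ≡⟨ cong₂ ℚ._-_
         (trans (*₂-congʳ (inY var) (inX-*₂ log1+ log1+) (suc m) n) (inY-*₂-inX var log1+² (suc m) n))
         (trans (*₂-congʳ (inX var) (inY-*₂ log1+ log1+) (suc m) n) (inX-*₂-inY var log1+² (suc m) n)) ⟩
  var n ℚ.* log1+² (suc m) ℚ.- var (suc m) ℚ.* log1+² n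
    ≡⟨ cong (λ o → var n ℚ.* log1+² (suc m) ℚ.- o ℚ.* log1+² n) (var-suc m) ⟩
  var n ℚ.* log1+² (suc m) ℚ.- one m ℚ.* log1+² n ∎

*₁-log1+ : ∀ f n → (f *₁ log1+) n ≡ ∑< n λ k → f k ℚ.* log1+ (n ∸ k)
*₁-log1+ f n = begin
  (f *₁ log1+) n
    ≡⟨ ∑<-snoc n (λ k → f k ℚ.* log1+ (n ∸ k)) ⟩
  ∑< n (λ k → f k ℚ.* log1+ (n ∸ k)) ℚ.+ f n ℚ.* log1+ (n ∸ n)
    ≡⟨ cong (λ z → ∑< n (λ k → f k ℚ.* log1+ (n ∸ k)) ℚ.+ f n ℚ.* log1+ z) (ℕₚ.n∸n≡0 n) ⟩
  ∑< n (λ k → f k ℚ.* log1+ (n ∸ k)) ℚ.+ f n ℚ.* 0ℚ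
    ≡⟨ solve 2 (λ s a → s :+ a :* con 0ℚ := s) refl (∑< n (λ k → f k ℚ.* log1+ (n ∸ k))) (f n) ⟩
  ∑< n (λ k → f k ℚ.* log1+ (n ∸ k)) ∎

*₁-log1+-suc : ∀ f n → (f *₁ log1+) (suc n) ≡ ∑< n (λ k → f k ℚ.* log1+ (suc n ∸ k)) ℚ.+ f n
*₁-log1+-suc f n = begin
  (f *₁ log1+) (suc n)
    ≡⟨ *₁-log1+ f (suc n) ⟩
  ∑< (suc n) (λ k → f k ℚ.* log1+ (suc n ∸ k))
    ≡⟨ ∑<-snoc n (λ k → f k ℚ.* log1+ (suc n ∸ k)) ⟩
  ∑< n (λ k → f k ℚ.* log1+ (suc n ∸ k)) ℚ.+ f n ℚ.* log1+ (suc n ∸ n)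
    ≡⟨ cong (λ z → ∑< n (λ k → f k ℚ.* log1+ (suc n ∸ k)) ℚ.+ f n ℚ.* log1+ z) (ℕₚ.m+n∸n≡m 1 n) ⟩
  ∑< n (λ k → f k ℚ.* log1+ (suc n ∸ k)) ℚ.+ f n ℚ.* 1ℚ
    ≡⟨ cong (∑< n (λ k → f k ℚ.* log1+ (suc n ∸ k)) ℚ.+_) (ℚₚ.*-identityʳ (f n)) ⟩
  ∑< n (λ k → f k ℚ.* log1+ (suc n ∸ k)) ℚ.+ f n ∎

-- log (1 + x) has no constant term and linear coefficient 1, so
-- the equation at (m + 1, n) expresses F m n through the F k n with k < m and
-- the F (suc m) l with l < n.
gregory-unique : ∀ {F G} → (∀ m n → GregoryAt F m n) → (∀ m n → GregoryAt G m n) → F ≈₂ G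
gregory-unique {F} {G} eqF eqG m n =
  -- The outer induction on n is uniform in m, because the solved equation refers to entries with
  -- smaller n but larger first index; the inner induction is on m.
  <-rec (λ n → ∀ m → F m n ≡ G m n)
    (λ n rec-n → <-rec (λ m → F m n ≡ G m n) (step n rec-n)) n m
  where
  below : Series₂ → ℕ → ℕ → ℚ
  below F m n = ∑< m λ k → F k n ℚ.* log1+ (suc m ∸ k)
  left : Series₂ → ℕ → ℕ → ℚ
  left F m n = ∑< n λ l → F (suc m) l ℚ.* log1+ (n ∸ l)
  rhs : ℕ → ℕ → ℚ
  rhs m n = var n ℚ.* log1+² (suc m) ℚ.- one m ℚ.* log1+² n

  solved : ∀ F → (∀ m n → GregoryAt F m n) → ∀ m n → F m n ≡ rhs m n ℚ.+ left F m n ℚ.- below F m n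
  solved F eq m n = begin
    F m n
      ≡⟨ solve 3 (λ f b l → f := b :+ f :- l :+ l :- b) refl (F m n) (below F m n) (left F m n) ⟩
    below F m n ℚ.+ F m n ℚ.- left F m n ℚ.+ left F m n ℚ.- below F m n
      ≡⟨ cong₂ (λ a b → a ℚ.- b ℚ.+ left F m n ℚ.- below F m n) (*₁-log1+-suc (λ k → F k n) m)
          (*₁-log1+ (F (suc m)) n) ⟨
    ((λ k → F k n) *₁ log1+) (suc m) ℚ.- (F (suc m) *₁ log1+) n ℚ.+ left F m n ℚ.- below F m n
      ≡⟨ cong (λ a → a ℚ.+ left F m n ℚ.- below F m n) (eq m n) ⟩
    rhs m n ℚ.+ left F m n ℚ.- below F m n ∎

  step : ∀ n → (∀ {l} → l < n → ∀ m → F m l ≡ G m l) → ∀ m → (∀ {k} → k < m → F k n ≡ G k n) → F m n ≡ G m n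
  step n rec-n m rec-m = begin
    F m n
      ≡⟨ solved F eqF m n ⟩
    rhs m n ℚ.+ left F m n ℚ.- below F m n
      ≡⟨ cong₂ (λ a b → rhs m n ℚ.+ a ℚ.- b)
           (∑<-cong n (λ {l} l<n → cong (ℚ._* log1+ (n ∸ l)) (rec-n l<n (suc m))))
           (∑<-cong m (λ {k} k<m → cong (ℚ._* log1+ (suc m ∸ k)) (rec-m k<m))) ⟩
    rhs m n ℚ.+ left G m n ℚ.- below G m n
      ≡⟨ solved G eqG m n ⟨
    G m n ∎

-- Tuples as lattice paths

-- Has the shape of the sum in `C`, so that the two agree by computation.
∑L : ∀ {A : Set} → (A → ℚ) → List A → ℚ
∑L f xs = List.foldr ℚ._+_ 0ℚ (List.map f xs)

∑L-cong : ∀ {A : Set} {f g : A → ℚ} → (∀ x → f x ≡ g x) → ∀ xs → ∑L f xs ≡ ∑L g xs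
∑L-cong f≗g []       = refl
∑L-cong f≗g (x ∷ xs) = cong₂ ℚ._+_ (f≗g x) (∑L-cong f≗g xs)

∑L-*ˡ : ∀ {A : Set} c (f : A → ℚ) xs → ∑L (λ x → c ℚ.* f x) xs ≡ c ℚ.* ∑L f xs
∑L-*ˡ c f []       = sym (ℚₚ.*-zeroʳ c)
∑L-*ˡ c f (x ∷ xs) = trans (cong (c ℚ.* f x ℚ.+_) (∑L-*ˡ c f xs)) (sym (ℚₚ.*-distribˡ-+ c (f x) (∑L f xs)))

∑L-zero : ∀ {A : Set} (xs : List A) → ∑L (λ _ → 0ℚ) xs ≡ 0ℚ
∑L-zero []       = refl
∑L-zero (x ∷ xs) = cong (0ℚ ℚ.+_) (∑L-zero xs)

∑L-++ : ∀ {A : Set} (f : A → ℚ) xs ys → ∑L f (xs ++ ys) ≡ ∑L f xs ℚ.+ ∑L f ys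
∑L-++ f []       ys = sym (ℚₚ.+-identityˡ _)
∑L-++ f (x ∷ xs) ys = trans (cong (f x ℚ.+_) (∑L-++ f xs ys)) (sym (ℚₚ.+-assoc (f x) (∑L f xs) (∑L f ys)))

∑L-tuples : ∀ b k (f : Vec ℕ (suc k) → ℚ) →
            ∑L f (tuples b (suc k)) ≡ ∑< (suc b) λ m → ∑L (λ v → f (m ∷ v)) (tuples b k)
∑L-tuples b k f = go (suc b) (λ m → m)
  where
  -- `upTo` is `applyUpTo` of the identity, whose recursion composes with `suc`; hence the
  -- generalisation to any `g`.
  go : ∀ n (g : ℕ → ℕ) → ∑L f (cartesianProductWith _∷_ (applyUpTo g n) (tuples b k))
                       ≡ ∑< n λ m → ∑L (λ v → f (g m ∷ v)) (tuples b k)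
  go zero    g = refl
  go (suc n) g = trans
    (∑L-++ f (List.map (g 0 ∷_) (tuples b k)) _)
    (cong₂ ℚ._+_ (cong (List.foldr ℚ._+_ 0ℚ) (sym (map-∘ (tuples b k)))) (go n (g ∘ suc)))

-- The characteristic function of `P` scaled by `p`, given as a relation so that a recursively
-- computed weight can be compared with a predicate without deciding it.
record Indicates (P : Set) (p x : ℚ) : Set where
  constructor _,_
  field
    accept : P → x ≡ p
    reject : ¬ P → x ≡ 0ℚ

open Indicates

∑L-filter : ∀ {A : Set} {P : A → Set} (P? : Decidable P) {f g : A → ℚ} →
            (∀ x → Indicates (P x) (f x) (g x)) → ∀ xs → ∑L f (List.filter P? xs) ≡ ∑L g xs
∑L-filter P? ind [] = refl
∑L-filter P? {f} {g} ind (x ∷ xs) with P? x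
... | yes Px = cong₂ ℚ._+_ (sym (accept (ind x) Px)) (∑L-filter P? ind xs)
... | no ¬Px = trans (∑L-filter P? ind xs)
    (sym (trans (cong (ℚ._+ ∑L g xs) (reject (ind x) ¬Px)) (ℚₚ.+-identityˡ _)))

-- A step m - 1 from height l leads to l + m - 1. With n = l + m, the case n = 0 is the step that
-- falls below 0 and gets weight 0.
ifPositive : ℕ → (ℕ → ℚ) → ℚ
ifPositive zero    f = 0ℚ
ifPositive (suc h) f = f h

ifPositive-cong : ∀ n {f g : ℕ → ℚ} → (∀ h → f h ≡ g h) → ifPositive n f ≡ ifPositive n g
ifPositive-cong zero    f≗g = refl
ifPositive-cong (suc h) f≗g = f≗g h

∑L-ifPositive : ∀ {A : Set} c n (F : ℕ → A → ℚ) xs →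
                ∑L (λ x → c ℚ.* ifPositive n (λ h → F h x)) xs ≡ c ℚ.* ifPositive n (λ h → ∑L (F h) xs)
∑L-ifPositive c zero    F xs = trans (∑L-*ˡ c (λ _ → 0ℚ) xs) (cong (c ℚ.*_) (∑L-zero xs))
∑L-ifPositive c (suc h) F xs = ∑L-*ˡ c (F h) xs

-- For k = 0 both sides vanish, since log^0 = 1 has no term of positive degree; hence the degree
-- `suc n`.
ifPositive-log^ : ∀ k n → ifPositive k (λ h → log^ (suc h) (suc n)) ≡ log^ k (suc n)
ifPositive-log^ zero    n = refl
ifPositive-log^ (suc k) n = refl

-- One step of a path: `Q` concerns the whole tuple, `P h` its tail started at the new height, and
-- `c` is the weight of the first entry.
indicates-step : ∀ {Q : Set} {P : ℕ → Set} c n {p f} →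
                 (Q → ∃ λ h → n ≡ suc h × P h) → (∀ {h} → n ≡ suc h → P h → Q) →
                 (∀ h → Indicates (P h) p (f h)) → Indicates Q (c ℚ.* p) (c ℚ.* ifPositive n f)
indicates-step c zero to from ind .accept q with to q
... | _ , () , _
indicates-step c zero to from ind .reject ¬q = ℚₚ.*-zeroʳ c
indicates-step c (suc h) to from ind .accept q with to q
... | _ , refl , Ph = cong (c ℚ.*_) (accept (ind h) Ph)
indicates-step c (suc h) to from ind .reject ¬q = trans (cong (c ℚ.*_) (reject (ind h) (¬q ∘ from refl)))
    (ℚₚ.*-zeroʳ c)

∑v : ∀ {n} → Vec ℕ n → ℕ
∑v v = sum (toList v)

-- A tuple is read as the path with steps n_j - 1.  Nonneg l says that the path
-- from height l ends at 0 without going below 0; Descent j h says that the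
-- path from height -h ends at 0, is below 0 after each of the first j steps, and
-- is nonnegative afterwards.
Nonneg : ∀ {n} → ℕ → Vec ℕ n → Set
Nonneg {n} l v = l + ∑v v ≡ n × (∀ {a} → a < n → sum (List.drop a (toList v)) ≤ n ∸ a)

Descent : ∀ {r} → ℕ → ℕ → Vec ℕ r → Set
Descent {r} j h v =
    ∑v v ≡ h + r
  × (∀ {a} → a < suc j → 1 ≤ a → sum (List.take a (toList v)) < h + a)
  × (∀ {a} → a < r → suc j ≤ a → sum (List.drop a (toList v)) ≤ r ∸ a)

-- The suffix condition at a = 1. For an empty tail that index is out of range, but then the sum is
-- 0.
drop-bound : ∀ {n} m (v : Vec ℕ n) →
             (∀ {a} → a < suc n → 1 ≤ a → sum (List.drop a (toList (m ∷ v))) ≤ suc n ∸ a) → ∑v v ≤ n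
drop-bound m []        _     = z≤n
drop-bound m v@(_ ∷ _) drops = drops (s≤s z<s) ℕₚ.≤-refl

∸-suc : ∀ m n {k} → m ∸ n ≡ suc k → m ≡ n + suc k
∸-suc m       zero    eq = eq
∸-suc (suc m) (suc n) eq = cong suc (∸-suc m n eq)

-- The height after the first step is read off the tail: `n ∸ ∑v v` is the height from which the
-- tail ends at 0, and `drop-bound` makes this subtraction exact.
nonneg-∷ : ∀ {n} l m (v : Vec ℕ n) → Nonneg l (m ∷ v) → ∃ λ h → l + m ≡ suc h × Nonneg h v
nonneg-∷ {n} l m v (eq , drops) = n ∸ ∑v v , ℕₚ.+-cancelʳ-≡ (∑v v) (l + m) (suc (n ∸ ∑v v)) (begin
  l + m + ∑v v                  ≡⟨ ℕₚ.+-assoc l m (∑v v) ⟩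
  l + (m + ∑v v)                ≡⟨ eq ⟩
  suc n                         ≡⟨ cong suc (ℕₚ.m∸n+n≡m v≤n) ⟨
  suc (n ∸ ∑v v) + ∑v v         ∎)
  , ℕₚ.m∸n+n≡m v≤n , drops ∘ s≤s
  where
  v≤n : ∑v v ≤ n
  v≤n = drop-bound m v (λ a<n _ → drops a<n)

nonneg-∷⁻ : ∀ {n} l m (v : Vec ℕ n) {h} → l + m ≡ suc h → Nonneg h v → Nonneg l (m ∷ v)
nonneg-∷⁻ {n} l m v {h} eq (eqv , drops) = total , λ
  { {zero}  _   → ℕₚ.≤-trans (ℕₚ.m≤n+m (m + ∑v v) l) (ℕₚ.≤-reflexive total)
  ; {suc a} a<n → drops (s≤s⁻¹ a<n)
  }
  where
  total : l + (m + ∑v v) ≡ suc n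
  total = trans (sym (ℕₚ.+-assoc l m (∑v v))) (trans (cong (_+ ∑v v) eq) (cong suc eqv))

-- The jump: from -h a step m - 1 reaches l = m - h - 1, so l is nonnegative exactly when `m ∸ h` is
-- a successor.
descent-0-∷ : ∀ {n} h m (v : Vec ℕ n) → Descent 0 h (m ∷ v) → ∃ λ l → m ∸ h ≡ suc l × Nonneg l v
descent-0-∷ {n} h m v (eq , _ , drops) = n ∸ ∑v v , trans (cong (_∸ h) split) (ℕₚ.m+n∸m≡n h _)
  , ℕₚ.m∸n+n≡m v≤n , λ a<n → drops (s≤s a<n) (s≤s z≤n)
  where
  v≤n : ∑v v ≤ n
  v≤n = drop-bound m v drops
  split : m ≡ h + suc (n ∸ ∑v v)
  split = ℕₚ.+-cancelʳ-≡ (∑v v) m _ (begin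
    m + ∑v v                          ≡⟨ eq ⟩
    h + suc n                         ≡⟨ cong (λ k → h + suc k) (ℕₚ.m∸n+n≡m v≤n) ⟨
    h + (suc (n ∸ ∑v v) + ∑v v)       ≡⟨ ℕₚ.+-assoc h _ (∑v v) ⟨
    h + suc (n ∸ ∑v v) + ∑v v         ∎)

descent-0-∷⁻ : ∀ {n} h m (v : Vec ℕ n) {l} → m ∸ h ≡ suc l → Nonneg l v → Descent 0 h (m ∷ v)
descent-0-∷⁻ {n} h m v {l} eq (eqv , drops) = total , (λ { (s≤s z≤n) () }) , λ
  { {suc a} a<n _ → drops (s≤s⁻¹ a<n) }
  where
  total : m + ∑v v ≡ h + suc n
  total = begin
    m + ∑v v             ≡⟨ cong (_+ ∑v v) (∸-suc m h eq) ⟩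
    h + suc l + ∑v v     ≡⟨ ℕₚ.+-assoc h (suc l) (∑v v) ⟩
    h + suc (l + ∑v v)   ≡⟨ cong (λ k → h + suc k) eqv ⟩
    h + suc n            ∎

-- From -h a step m - 1 leads to -(h + 1 - m). The prefix condition at a = 1 gives m ≤ h, so the new
-- depth is positive, whence the form `suc h′`.
descent-∷ : ∀ {n} j h m (v : Vec ℕ n) → Descent (suc j) h (m ∷ v) →
            ∃ λ h′ → suc h ∸ m ≡ suc h′ × Descent j (suc h′) v
descent-∷ {n} j h m v (eq , takes , drops) = h ∸ m , ℕₚ.+-∸-assoc 1 m≤h
  , ℕₚ.+-cancelˡ-≡ m _ _ (trans eq (shift n))
  , (λ {a} a<j 1≤a → ℕₚ.+-cancelˡ-< m _ _ (ℕₚ.<-≤-trans (takes (s≤s a<j) (s≤s z≤n)) (ℕₚ.≤-reflexive (shift a))))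
  , λ a<n j≤a → drops (s≤s a<n) (s≤s j≤a)
  where
  m≤h : m ≤ h
  m≤h = s≤s⁻¹ (ℕₚ.≤-trans (s≤s (ℕₚ.m≤m+n m 0))
      (ℕₚ.≤-trans (takes (s≤s (s≤s z≤n)) ℕₚ.≤-refl) (ℕₚ.≤-reflexive (ℕₚ.+-comm h 1))))
  shift : ∀ a → h + suc a ≡ m + (suc (h ∸ m) + a)
  shift a = begin
    h + suc a                 ≡⟨ cong (_+ suc a) (ℕₚ.m+[n∸m]≡n m≤h) ⟨
    m + (h ∸ m) + suc a       ≡⟨ ℕₚ.+-assoc m (h ∸ m) (suc a) ⟩
    m + (h ∸ m + suc a)       ≡⟨ cong (m +_) (ℕₚ.+-suc (h ∸ m) a) ⟩
    m + (suc (h ∸ m) + a)     ∎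

descent-∷⁻ : ∀ {n} j h m (v : Vec ℕ n) {h′} → suc h ∸ m ≡ suc h′ → Descent j (suc h′) v → Descent (suc j) h (m ∷ v)
descent-∷⁻ {n} j h m v {h′} eq (eqv , takes , drops) =
    trans (cong (m +_) eqv) (sym (shift n))
  , (λ
      { {suc zero}    _   _ → ℕₚ.≤-trans (ℕₚ.+-monoʳ-< m (s≤s z≤n)) (ℕₚ.≤-reflexive (sym (shift 0)))
      ; {suc (suc a)} a<j _ → ℕₚ.≤-trans (ℕₚ.+-monoʳ-< m (takes (s≤s⁻¹ a<j) (s≤s z≤n)))
          (ℕₚ.≤-reflexive (sym (shift (suc a))))
      })
  , λ { {suc a} a<n j≤a → drops (s≤s⁻¹ a<n) (s≤s⁻¹ j≤a) }
  where
  shift : ∀ a → h + suc a ≡ m + (suc h′ + a)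
  shift a = begin
    h + suc a              ≡⟨ ℕₚ.+-suc h a ⟩
    suc h + a              ≡⟨ cong (_+ a) (∸-suc (suc h) m eq) ⟩
    m + suc h′ + a         ≡⟨ ℕₚ.+-assoc m (suc h′) a ⟩
    m + (suc h′ + a)       ∎

weight : Series → ∀ {n} → Vec ℕ n → ℚ
weight w v = Vec.foldr′ ℚ._*_ 1ℚ (Vec.map w v)

nonnegWeight : Series → ∀ {n} → ℕ → Vec ℕ n → ℚ
nonnegWeight w zero    []      = 1ℚ
nonnegWeight w (suc l) []      = 0ℚ
nonnegWeight w l       (m ∷ v) = w m ℚ.* ifPositive (l + m) λ h → nonnegWeight w h v

descentWeight : Series → ∀ {n} → ℕ → ℕ → Vec ℕ n → ℚ
-- A default value: a jump needs an entry, and `descentWeight-indicates` assumes j < n.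
descentWeight w j       h []      = 0ℚ
descentWeight w zero    h (m ∷ v) = w m ℚ.* ifPositive (m ∸ h) λ l → nonnegWeight w l v
descentWeight w (suc j) h (m ∷ v) = w m ℚ.* ifPositive (suc h ∸ m) λ h′ → descentWeight w j (suc h′) v

nonnegWeight-indicates : ∀ w {n} l (v : Vec ℕ n) → Indicates (Nonneg l v) (weight w v) (nonnegWeight w l v)
nonnegWeight-indicates w zero    []      = (λ _ → refl) , λ ¬p → contradiction (refl , λ ()) ¬p
nonnegWeight-indicates w (suc l) []      = (λ { (() , _) }) , λ _ → refl
nonnegWeight-indicates w zero    (m ∷ v) =
  indicates-step (w m) m (nonneg-∷ 0 m v) (nonneg-∷⁻ 0 m v) (λ h → nonnegWeight-indicates w h v)
nonnegWeight-indicates w (suc l) (m ∷ v) =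
  indicates-step (w m) (suc l + m) (nonneg-∷ (suc l) m v) (nonneg-∷⁻ (suc l) m v)
      (λ h → nonnegWeight-indicates w h v)

descentWeight-indicates : ∀ w {n} j h (v : Vec ℕ n) → j < n → Indicates (Descent j h v) (weight w v)
    (descentWeight w j h v)
descentWeight-indicates w zero    h (m ∷ v) _   =
  indicates-step (w m) (m ∸ h) (descent-0-∷ h m v) (descent-0-∷⁻ h m v) (λ l → nonnegWeight-indicates w l v)
descentWeight-indicates w (suc j) h (m ∷ v) j<n =
  indicates-step (w m) (suc h ∸ m) (descent-∷ j h m v) (descent-∷⁻ j h m v)
      (λ h′ → descentWeight-indicates w j (suc h′) v (s≤s⁻¹ j<n))

-- Distributes a sign over the entries. An admissible tuple has total r, so this absorbs the factor
-- (-1)^r of `C` into the weights.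
weight-sign : ∀ t {n} (v : Vec ℕ n) → -1^ (∑v v) ℚ.* weight t v ≡ weight (λ k → -1^ k ℚ.* t k) v
weight-sign t []      = refl
weight-sign t (m ∷ v) = begin
  -1^ (m + ∑v v) ℚ.* (t m ℚ.* weight t v)
    ≡⟨ cong (ℚ._* (t m ℚ.* weight t v)) (-1^-+ m (∑v v)) ⟩
  -1^ m ℚ.* -1^ (∑v v) ℚ.* (t m ℚ.* weight t v)
    ≡⟨ solve 4 (λ a b c d → a :* b :* (c :* d) := a :* c :* (b :* d))
        refl (-1^ m) (-1^ (∑v v)) (t m) (weight t v) ⟩
  -1^ m ℚ.* t m ℚ.* (-1^ (∑v v) ℚ.* weight t v)
    ≡⟨ cong (-1^ m ℚ.* t m ℚ.*_) (weight-sign t v) ⟩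
  weight (λ k → -1^ k ℚ.* t k) (m ∷ v) ∎

-- The Bernoulli weights at u = log (1 + x)

module _ (B : ℕ → ℚ) (bernoulli : IsBernoulli B) where

  -- The coefficients of u / (e^u - 1), obtained from x e^x / (e^x - 1) at x = -u.
  w : Series
  w n = -1^ n ℚ.* (B n ℚ.* 1/ n !)

  -- With t(x) the Bernoulli series, the hypothesis reads t(x) e^x = t(x) + x e^x; replacing x by -u
  -- multiplies the coefficient in degree n by (-1)^n and gives w(u) e^(-u) = w(u) - u e^(-u).
  w*exp⁻ : ∀ n → (w *₁ exp⁻) n ≡ w n ℚ.+ -1^ n ℚ.* (var *₁ exp) n
  w*exp⁻ n = begin
    (w *₁ exp⁻) n
      ≡⟨ ∑<-cong (suc n) (λ {k} k≤n → sign k (s≤s⁻¹ k≤n)) ⟩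
    ∑< (suc n) (λ k → -1^ n ℚ.* (t k ℚ.* exp (n ∸ k)))
      ≡⟨ ∑<-*ˡ (suc n) (-1^ n) (λ k → t k ℚ.* exp (n ∸ k)) ⟨
    -1^ n ℚ.* (t *₁ exp) n
      ≡⟨ cong (-1^ n ℚ.*_) (begin
        (t *₁ exp) n                                ≡⟨ *₁-cong {t} (λ _ → refl)
            (λ m → solve 2 (λ e o → e := o :+ (e :- o)) refl (exp m) (one m)) n ⟩
        (t *₁ (λ m → one m ℚ.+ (exp -₁ one) m)) n   ≡⟨ *₁-+ʳ t one (exp -₁ one) n ⟩
        (t *₁ one) n ℚ.+ (t *₁ (exp -₁ one)) n      ≡⟨ cong₂ ℚ._+_ (*₁-identityʳ t n) (bernoulli n) ⟩
        t n ℚ.+ (var *₁ exp) n                      ∎) ⟩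
    -1^ n ℚ.* (t n ℚ.+ (var *₁ exp) n)
      ≡⟨ ℚₚ.*-distribˡ-+ (-1^ n) (t n) _ ⟩
    w n ℚ.+ -1^ n ℚ.* (var *₁ exp) n ∎
    where
    t : Series
    t k = B k ℚ.* 1/ k !
    sign : ∀ k → k ≤ n → w k ℚ.* exp⁻ (n ∸ k) ≡ -1^ n ℚ.* (t k ℚ.* exp (n ∸ k))
    sign k k≤n = begin
      -1^ k ℚ.* t k ℚ.* (-1^ (n ∸ k) ℚ.* exp (n ∸ k))
        ≡⟨ solve 4 (λ a b c d → a :* b :* (c :* d) := a :* c :* (b :* d))
            refl (-1^ k) (t k) (-1^ (n ∸ k)) (exp (n ∸ k)) ⟩
      -1^ k ℚ.* -1^ (n ∸ k) ℚ.* (t k ℚ.* exp (n ∸ k))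
        ≡⟨ cong (ℚ._* (t k ℚ.* exp (n ∸ k))) (trans (sym (-1^-+ k (n ∸ k))) (cong -1^_ (ℕₚ.m+[n∸m]≡n k≤n))) ⟩
      -1^ n ℚ.* (t k ℚ.* exp (n ∸ k)) ∎

  w*exp⁻-suc : ∀ n → (w *₁ exp⁻) (suc n) ≡ w (suc n) ℚ.- exp⁻ n
  w*exp⁻-suc n = begin
    (w *₁ exp⁻) (suc n)
      ≡⟨ w*exp⁻ (suc n) ⟩
    w (suc n) ℚ.+ ℚ.- 1ℚ ℚ.* -1^ n ℚ.*
        (0ℚ ℚ.* exp (suc n) ℚ.+ (1ℚ ℚ.* exp n ℚ.+ ∑< n (λ k → 0ℚ ℚ.* exp (n ∸ suc k))))
      ≡⟨ cong (λ a → w (suc n) ℚ.+ ℚ.- 1ℚ ℚ.* -1^ n ℚ.* (0ℚ ℚ.* exp (suc n) ℚ.+ (1ℚ ℚ.* exp n ℚ.+ a)))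
           (∑<-zero n {λ k → 0ℚ ℚ.* exp (n ∸ suc k)} (λ {k} _ → ℚₚ.*-zeroˡ (exp (n ∸ suc k)))) ⟩
    w (suc n) ℚ.+ ℚ.- 1ℚ ℚ.* -1^ n ℚ.* (0ℚ ℚ.* exp (suc n) ℚ.+ (1ℚ ℚ.* exp n ℚ.+ 0ℚ))
      ≡⟨ solve 4 (λ w s e e′ → w :+ (:- con 1ℚ) :* s :* (con 0ℚ :* e′ :+ (con 1ℚ :* e :+ con 0ℚ)) := w :- s :* e)
          refl (w (suc n)) (-1^ n) (exp n) (exp (suc n)) ⟩
    w (suc n) ℚ.- exp⁻ n ∎

  -- The identity w(u) e^(-u) = w(u) - u e^(-u), times u^k, at u = log (1 + x). The double sum is
  -- regrouped by the total exponent of u.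
  ∑-w-E : ∀ {N n} k → n < N →
          ∑< N (λ m → w m ℚ.* E {N} (k + m) n) ≡ (w ∘log[ N ]) k n ℚ.- E {N} (suc k) n
  ∑-w-E {N} {n} k n<N = begin
    ∑< N (λ m → w m ℚ.* E {N} (k + m) n)
      ≡⟨ ∑<-cong N (λ {m} _ → ∑<-*ˡ N (w m) (λ j → exp⁻ j ℚ.* log^ (k + m + j) n)) ⟩
    ∑< N (λ m → ∑< N λ j → a m j)
      ≡⟨ ∑<-triangle ℕₚ.≤-refl a (λ {m} {j} → a≗0 {m} {j}) ⟩
    ∑< N (λ s → ∑< (suc s) λ m → a m (s ∸ m))
      ≡⟨ ∑<-cong N (λ {s} _ → diagonal s) ⟩
    ∑< N (λ s → (w *₁ exp⁻) s ℚ.* log^ (k + s) n)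
      ≡⟨ ∑<-cong N (λ {s} _ → solve 3 (λ c w l → c :* l := w :* l :+ (c :- w) :* l)
          refl ((w *₁ exp⁻) s) (w s) (log^ (k + s) n)) ⟩
    ∑< N (λ s → w s ℚ.* log^ (k + s) n ℚ.+ f s)
      ≡⟨ ∑<-+ N (λ s → w s ℚ.* log^ (k + s) n) f ⟩
    (w ∘log[ N ]) k n ℚ.+ ∑< N f
      ≡⟨ cong ((w ∘log[ N ]) k n ℚ.+_) (begin
        ∑< N f                                              ≡⟨ solve 2 (λ s l → s := s :- con 0ℚ :* l)
            refl (∑< N f) (log^ (k + 0) n) ⟩
        ∑< N f ℚ.- 0ℚ ℚ.* log^ (k + 0) n                    ≡⟨ cong (λ c → ∑< N f ℚ.- c ℚ.* log^ (k + 0) n) first ⟨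
        ∑< N f ℚ.- f 0                                      ≡⟨ ∑<-tail N {f}
            (log^-≥ k ((w *₁ exp⁻) N ℚ.- w N) n<N) ⟨
        ∑< N (f ∘ suc)                                      ≡⟨ ∑<-cong N (λ {j} _ → next j) ⟩
        ∑< N (λ j → ℚ.- (exp⁻ j ℚ.* log^ (suc k + j) n))    ≡⟨ ∑<-neg N (λ j → exp⁻ j ℚ.* log^ (suc k + j) n) ⟩
        ℚ.- E {N} (suc k) n                                 ∎) ⟩
    (w ∘log[ N ]) k n ℚ.- E {N} (suc k) n ∎
    where
    a : ℕ → ℕ → ℚ
    a m j = w m ℚ.* (exp⁻ j ℚ.* log^ (k + m + j) n)

    a≗0 : ∀ {m j} → N ≤ m + j → a m j ≡ 0ℚ
    a≗0 {m} {j} N≤m+j = begin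
      w m ℚ.* (exp⁻ j ℚ.* log^ (k + m + j) n)
        ≡⟨ cong (λ l → w m ℚ.* (exp⁻ j ℚ.* l))
            (log^-< (ℕₚ.<-≤-trans n<N (ℕₚ.≤-trans N≤m+j
                (ℕₚ.≤-trans (ℕₚ.m≤n+m (m + j) k) (ℕₚ.≤-reflexive (sym (ℕₚ.+-assoc k m j))))))) ⟩
      w m ℚ.* (exp⁻ j ℚ.* 0ℚ)
        ≡⟨ solve 2 (λ a b → a :* (b :* con 0ℚ) := con 0ℚ) refl (w m) (exp⁻ j) ⟩
      0ℚ ∎

    diagonal : ∀ s → ∑< (suc s) (λ m → a m (s ∸ m)) ≡ (w *₁ exp⁻) s ℚ.* log^ (k + s) n
    diagonal s = trans
      (∑<-cong (suc s) (λ {m} m≤s → trans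
        (sym (ℚₚ.*-assoc (w m) (exp⁻ (s ∸ m)) _))
        (cong (λ i → w m ℚ.* exp⁻ (s ∸ m) ℚ.* log^ i n)
          (trans (ℕₚ.+-assoc k m (s ∸ m)) (cong (k +_) (ℕₚ.m+[n∸m]≡n (s≤s⁻¹ m≤s)))))))
      (sym (∑<-*ʳ (suc s) (log^ (k + s) n) (λ m → w m ℚ.* exp⁻ (s ∸ m))))

    f : ℕ → ℚ
    f s = ((w *₁ exp⁻) s ℚ.- w s) ℚ.* log^ (k + s) n

    first : (w *₁ exp⁻) 0 ℚ.- w 0 ≡ 0ℚ
    first = solve 1 (λ a → a :* con 1ℚ :+ con 0ℚ :- a := con 0ℚ) refl (w 0)

    next : ∀ j → f (suc j) ≡ ℚ.- (exp⁻ j ℚ.* log^ (suc k + j) n)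
    next j = begin
      ((w *₁ exp⁻) (suc j) ℚ.- w (suc j)) ℚ.* log^ (k + suc j) n
        ≡⟨ cong₂ (λ c m → (c ℚ.- w (suc j)) ℚ.* log^ m n) (w*exp⁻-suc j) (ℕₚ.+-suc k j) ⟩
      (w (suc j) ℚ.- exp⁻ j ℚ.- w (suc j)) ℚ.* log^ (suc k + j) n
        ≡⟨ solve 3 (λ w e l → (w :- e :- w) :* l := :- (e :* l)) refl (w (suc j)) (exp⁻ j) (log^ (suc k + j) n) ⟩
      ℚ.- (exp⁻ j ℚ.* log^ (suc k + j) n) ∎

  -- log (1 + x) = x w (log (1 + x)), times log^k.
  w∘log : ∀ {N n} k → suc n < N → (w ∘log[ N ]) k n ≡ log^ (suc k) (suc n)
  w∘log {N} {n} k n<N = begin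
    X n
      -- Multiplying `∑-w-E` by 1 + x turns its left side into `X` and its right side into (1 + x)
      -- `X` minus log^(k+1). In degree n + 1 the two copies of `X (suc n)` cancel.
      ≡⟨ solve 4 (λ x x′ e e′ → x := (x′ :- e′ :+ (x :- e)) :+ (e′ :+ e) :- x′)
          refl (X n) (X (suc n)) (E {N} (suc k) n) (E {N} (suc k) (suc n)) ⟩
    X (suc n) ℚ.- E {N} (suc k) (suc n) ℚ.+ (X n ℚ.- E {N} (suc k) n) ℚ.+
        (E {N} (suc k) (suc n) ℚ.+ E {N} (suc k) n) ℚ.- X (suc n)
      ≡⟨ cong₂ (λ a b → a ℚ.+ b ℚ.- X (suc n)) collect ([1+x]E (suc k) n<N) ⟩
    X (suc n) ℚ.+ log^ (suc k) (suc n) ℚ.- X (suc n)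
      ≡⟨ solve 2 (λ a b → a :+ b :- a := b) refl (X (suc n)) (log^ (suc k) (suc n)) ⟩
    log^ (suc k) (suc n) ∎
    where
    X : Series
    X = (w ∘log[ N ]) k
    collect : X (suc n) ℚ.- E {N} (suc k) (suc n) ℚ.+ (X n ℚ.- E {N} (suc k) n) ≡ X (suc n)
    collect = begin
      X (suc n) ℚ.- E {N} (suc k) (suc n) ℚ.+ (X n ℚ.- E {N} (suc k) n)
        ≡⟨ cong₂ ℚ._+_ (∑-w-E k n<N) (∑-w-E k (ℕₚ.<-trans ℕₚ.≤-refl n<N)) ⟨
      ∑< N (λ m → w m ℚ.* E {N} (k + m) (suc n)) ℚ.+ ∑< N (λ m → w m ℚ.* E {N} (k + m) n)
        ≡⟨ ∑<-+ N (λ m → w m ℚ.* E {N} (k + m) (suc n)) (λ m → w m ℚ.* E {N} (k + m) n) ⟨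
      ∑< N (λ m → w m ℚ.* E {N} (k + m) (suc n) ℚ.+ w m ℚ.* E {N} (k + m) n)
        ≡⟨ ∑<-cong N (λ {m} _ → trans (sym
            (ℚₚ.*-distribˡ-+ (w m) (E {N} (k + m) (suc n)) (E {N} (k + m) n)))
                (cong (w m ℚ.*_) ([1+x]E (k + m) n<N))) ⟩
      X (suc n) ∎

  -- The double series K and its agreement with G

  -- The coefficient of x^i y^n in the sum over k and l of
  -- w (l + k + 1) log^k (1 + x) log^(l + 1) (1 + y).
  K : Series₂
  K i n = ∑< (suc i) λ k → ∑< n λ l → w (l + suc k) ℚ.* (log^ k i ℚ.* log^ (suc l) n)

  -- Larger ranges only add zero terms, since log^k starts in degree k. One common range can then
  -- serve all degrees in a Cauchy product.
  K-extend : ∀ {M N i n} → i < M → n ≤ N →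
             K i n ≡ ∑< M λ k → ∑< N λ l → w (l + suc k) ℚ.* (log^ k i ℚ.* log^ (suc l) n)
  K-extend {M} {N} {i} {n} i<M n≤N = sym (begin
    ∑< M (λ k → ∑< N (term k))
      ≡⟨ ∑<-extend i<M (λ {k} i<k → ∑<-zero N (λ {l} _ → trans
           (cong (λ a → w (l + suc k) ℚ.* (a ℚ.* log^ (suc l) n)) (log^-< i<k))
           (solve 2 (λ a b → a :* (con 0ℚ :* b) := con 0ℚ) refl (w (l + suc k)) (log^ (suc l) n)))) ⟩
    ∑< (suc i) (λ k → ∑< N (term k))
      ≡⟨ ∑<-cong (suc i) (λ {k} _ → ∑<-extend n≤N (λ {l} n≤l → trans
           (cong (λ a → w (l + suc k) ℚ.* (log^ k i ℚ.* a)) (log^-< (s≤s n≤l)))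
           (solve 2 (λ a b → a :* (b :* con 0ℚ) := con 0ℚ) refl (w (l + suc k)) (log^ k i)))) ⟩
    K i n ∎)
    where
    term : ℕ → ℕ → ℚ
    term k l = w (l + suc k) ℚ.* (log^ k i ℚ.* log^ (suc l) n)

  -- Multiplying by log (1 + x) - log (1 + y) telescopes the sum; the two ends
  -- are evaluated by log (1 + x) = x w (log (1 + x)).
  K-*-log : ∀ m n → ((λ k → K k n) *₁ log1+) m ℚ.- (K m *₁ log1+) n
                  ≡ log^ 1 (suc m) ℚ.* log^ 1 n ℚ.- one m ℚ.* log^ 2 (suc n)
  K-*-log m n = begin
    ((λ k → K k n) *₁ log1+) m ℚ.- (K m *₁ log1+) n
      ≡⟨ cong₂ ℚ._-_ timesX timesY ⟩
    ∑< N (λ k → ∑< N (a (suc k))) ℚ.- ∑< N (λ k → ∑< N (a k) ℚ.- a k 0)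
      ≡⟨ cong₂ ℚ._-_ (∑<-tail N {λ k → ∑< N (a k)} (∑<-zero N (λ {l} _ → top l)))
          (∑<-- N (λ k → ∑< N (a k)) (λ k → a k 0)) ⟩
    ∑< N (λ k → ∑< N (a k)) ℚ.- ∑< N (a 0) ℚ.- (∑< N (λ k → ∑< N (a k)) ℚ.- ∑< N (λ k → a k 0))
      ≡⟨ solve 3 (λ s b c → s :- b :- (s :- c) := c :- b) refl (∑< N (λ k → ∑< N (a k))) (∑< N (a 0))
          (∑< N (λ k → a k 0)) ⟩
    ∑< N (λ k → a k 0) ℚ.- ∑< N (a 0)
      ≡⟨ cong₂ ℚ._-_ edgeX edgeY ⟩
    log^ 1 (suc m) ℚ.* log^ 1 n ℚ.- one m ℚ.* log^ 2 (suc n) ∎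
    where
    N : ℕ
    N = suc (suc (m + n))

    m<N : suc m < N
    m<N = s≤s (s≤s (ℕₚ.m≤m+n m n))

    n<N : suc n < N
    n<N = s≤s (s≤s (ℕₚ.m≤n+m n m))

    -- Multiplication by log (1 + x) gives the entries of this array with k ≥ 1, and by log (1 + y)
    -- those with l ≥ 1, so the difference is the edge l = 0 minus the edge k = 0.
    a : ℕ → ℕ → ℚ
    a k l = w (l + k) ℚ.* (log^ k m ℚ.* log^ (suc l) n)

    top : ∀ l → a N l ≡ 0ℚ
    top l = trans
      (cong (λ b → w (l + N) ℚ.* (b ℚ.* log^ (suc l) n)) (log^-< (ℕₚ.<-trans ℕₚ.≤-refl m<N)))
      (solve 2 (λ a b → a :* (con 0ℚ :* b) := con 0ℚ) refl (w (l + N)) (log^ (suc l) n))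

    timesX : ((λ k → K k n) *₁ log1+) m ≡ ∑< N λ k → ∑< N (a (suc k))
    timesX = begin
      ((λ j → K j n) *₁ log1+) m
        ≡⟨ ∑<-cong (suc m) (λ {j} j≤m → cong (ℚ._* log1+ (m ∸ j))
            (K-extend {N} {N} (ℕₚ.<-≤-trans j≤m (ℕₚ.<⇒≤ m<N)) (ℕₚ.≤-trans (ℕₚ.n≤1+n n) (ℕₚ.<⇒≤ n<N)))) ⟩
      ((λ j → ∑< N λ k → ∑< N λ l → w (l + suc k) ℚ.* (log^ k j ℚ.* log^ (suc l) n)) *₁ log1+) m
        ≡⟨ ∑-*₁ N (λ k j → ∑< N λ l → w (l + suc k) ℚ.* (log^ k j ℚ.* log^ (suc l) n)) log1+ m ⟩
      ∑< N (λ k → ((λ j → ∑< N λ l → w (l + suc k) ℚ.* (log^ k j ℚ.* log^ (suc l) n)) *₁ log1+) m)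
        ≡⟨ ∑<-cong N (λ {k} _ → trans
             (∑-*₁ N (λ l j → w (l + suc k) ℚ.* (log^ k j ℚ.* log^ (suc l) n)) log1+ m)
             (∑<-cong N (λ {l} _ → term k l))) ⟩
      ∑< N (λ k → ∑< N (a (suc k))) ∎
      where
      term : ∀ k l → ((λ j → w (l + suc k) ℚ.* (log^ k j ℚ.* log^ (suc l) n)) *₁ log1+) m ≡ a (suc k) l
      term k l = begin
        ((λ j → c ℚ.* (log^ k j ℚ.* d)) *₁ log1+) m
          ≡⟨ *₁-cong {g = log1+} (λ j → solve 3 (λ c x d → c :* (x :* d) := c :* d :* x)
              refl c (log^ k j) d) (λ _ → refl) m ⟩
        ((λ j → c ℚ.* d ℚ.* log^ k j) *₁ log1+) m
          ≡⟨ scale-*₁ (c ℚ.* d) (log^ k) log1+ m ⟩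
        c ℚ.* d ℚ.* log^ (suc k) m
          ≡⟨ solve 3 (λ c x d → c :* d :* x := c :* (x :* d)) refl c (log^ (suc k) m) d ⟩
        c ℚ.* (log^ (suc k) m ℚ.* d) ∎
        where
        c d : ℚ
        c = w (l + suc k)
        d = log^ (suc l) n

    timesY : (K m *₁ log1+) n ≡ ∑< N λ k → ∑< N (a k) ℚ.- a k 0
    timesY = begin
      (K m *₁ log1+) n
        ≡⟨ ∑<-cong (suc n) (λ {j} j≤n → cong (ℚ._* log1+ (n ∸ j))
            (K-extend {N} {N} (ℕₚ.<-trans ℕₚ.≤-refl m<N)
                (ℕₚ.≤-trans (s≤s⁻¹ j≤n) (ℕₚ.≤-trans (ℕₚ.n≤1+n n) (ℕₚ.<⇒≤ n<N))))) ⟩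
      ((λ j → ∑< N λ k → ∑< N λ l → w (l + suc k) ℚ.* (log^ k m ℚ.* log^ (suc l) j)) *₁ log1+) n
        ≡⟨ ∑-*₁ N (λ k j → ∑< N λ l → w (l + suc k) ℚ.* (log^ k m ℚ.* log^ (suc l) j)) log1+ n ⟩
      ∑< N (λ k → ((λ j → ∑< N λ l → w (l + suc k) ℚ.* (log^ k m ℚ.* log^ (suc l) j)) *₁ log1+) n)
        ≡⟨ ∑<-cong N (λ {k} _ → trans
             (∑-*₁ N (λ l j → w (l + suc k) ℚ.* (log^ k m ℚ.* log^ (suc l) j)) log1+ n)
             (trans (∑<-cong N (λ {l} _ → term k l)) (∑<-tail N {a k} (top′ k)))) ⟩
      ∑< N (λ k → ∑< N (a k) ℚ.- a k 0) ∎
      where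
      top′ : ∀ k → a k N ≡ 0ℚ
      top′ k = trans
        (cong (λ b → w (N + k) ℚ.* (log^ k m ℚ.* b)) (log^-< (ℕₚ.<-trans ℕₚ.≤-refl (ℕₚ.<-trans n<N ℕₚ.≤-refl))))
        (solve 2 (λ a b → a :* (b :* con 0ℚ) := con 0ℚ) refl (w (N + k)) (log^ k m))
      term : ∀ k l → ((λ j → w (l + suc k) ℚ.* (log^ k m ℚ.* log^ (suc l) j)) *₁ log1+) n ≡ a k (suc l)
      term k l = begin
        ((λ j → c ℚ.* (d ℚ.* log^ (suc l) j)) *₁ log1+) n
          ≡⟨ *₁-cong {g = log1+} (λ j → sym (ℚₚ.*-assoc c d (log^ (suc l) j))) (λ _ → refl) n ⟩
        ((λ j → c ℚ.* d ℚ.* log^ (suc l) j) *₁ log1+) n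
          ≡⟨ scale-*₁ (c ℚ.* d) (log^ (suc l)) log1+ n ⟩
        c ℚ.* d ℚ.* log^ (suc (suc l)) n
          ≡⟨ ℚₚ.*-assoc c d _ ⟩
        c ℚ.* (d ℚ.* log^ (suc (suc l)) n)
          ≡⟨ cong (λ j → w j ℚ.* (d ℚ.* log^ (suc (suc l)) n)) (ℕₚ.+-suc l k) ⟩
        a k (suc l) ∎
        where
        c d : ℚ
        c = w (l + suc k)
        d = log^ k m

    edgeX : ∑< N (λ k → a k 0) ≡ log^ 1 (suc m) ℚ.* log^ 1 n
    edgeX = begin
      ∑< N (λ k → w k ℚ.* (log^ k m ℚ.* log^ 1 n))
        ≡⟨ ∑<-cong N (λ {k} _ → sym (ℚₚ.*-assoc (w k) (log^ k m) (log^ 1 n))) ⟩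
      ∑< N (λ k → w k ℚ.* log^ k m ℚ.* log^ 1 n)
        ≡⟨ ∑<-*ʳ N (log^ 1 n) (λ k → w k ℚ.* log^ k m) ⟨
      (w ∘log[ N ]) 0 m ℚ.* log^ 1 n
        ≡⟨ cong (ℚ._* log^ 1 n) (w∘log 0 m<N) ⟩
      log^ 1 (suc m) ℚ.* log^ 1 n ∎

    edgeY : ∑< N (a 0) ≡ one m ℚ.* log^ 2 (suc n)
    edgeY = begin
      ∑< N (λ l → w (l + 0) ℚ.* (one m ℚ.* log^ (suc l) n))
        ≡⟨ ∑<-cong N (λ {l} _ → trans
             (cong (λ j → w j ℚ.* (one m ℚ.* log^ (suc l) n)) (ℕₚ.+-identityʳ l))
             (solve 3 (λ w o l → w :* (o :* l) := o :* (w :* l)) refl (w l) (one m) (log^ (suc l) n))) ⟩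
      ∑< N (λ l → one m ℚ.* (w l ℚ.* log^ (suc l) n))
        ≡⟨ ∑<-*ˡ N (one m) (λ l → w l ℚ.* log^ (suc l) n) ⟨
      one m ℚ.* (w ∘log[ N ]) 1 n
        ≡⟨ cong (one m ℚ.*_) (w∘log 1 n<N) ⟩
      one m ℚ.* log^ 2 (suc n) ∎

  -- The second summand of the last clause is the coefficient of y log (1 + x).
  H : Series₂
  H zero    n       = 0ℚ
  H (suc m) zero    = 0ℚ
  H (suc m) (suc n) = K m n ℚ.+ one n ℚ.* log1+ (suc m)

  H-0 : ∀ m → H m 0 ≡ 0ℚ
  H-0 zero    = refl
  H-0 (suc m) = refl

  -- The summand y log (1 + x) of `H` contributes y log^2 (1 + x) - y log (1 + x) log (1 + y), whose
  -- second part cancels the mixed product left by `K-*-log`.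
  H-gregoryAt : ∀ m n → GregoryAt H m n
  H-gregoryAt m zero = begin
    ((λ k → H k 0) *₁ log1+) (suc m) ℚ.- (0ℚ ℚ.* 0ℚ ℚ.+ 0ℚ)
      ≡⟨ cong (ℚ._- (0ℚ ℚ.* 0ℚ ℚ.+ 0ℚ)) (*₁-zeroˡ log1+ (suc m) H-0) ⟩
    0ℚ ℚ.- (0ℚ ℚ.* 0ℚ ℚ.+ 0ℚ)
      ≡⟨ solve 2 (λ a o → con 0ℚ :- (con 0ℚ :* con 0ℚ :+ con 0ℚ) := con 0ℚ :* a :- o :*
          (con 0ℚ :* con 0ℚ :+ con 0ℚ)) refl (log1+² (suc m)) (one m) ⟩
    0ℚ ℚ.* log1+² (suc m) ℚ.- one m ℚ.* (0ℚ ℚ.* 0ℚ ℚ.+ 0ℚ) ∎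
  H-gregoryAt m (suc n) = begin
    ((λ k → H k (suc n)) *₁ log1+) (suc m) ℚ.- (H (suc m) *₁ log1+) (suc n)
      ≡⟨ cong₂ ℚ._-_ alongX alongY ⟩
    Kx ℚ.+ one n ℚ.* log1+² (suc m) ℚ.- (Ky ℚ.+ log1+ (suc m) ℚ.* log1+ n)
      ≡⟨ solve 4 (λ x y s t → x :+ s :- (y :+ t) := x :- y :+ s :- t)
          refl Kx Ky (one n ℚ.* log1+² (suc m)) (log1+ (suc m) ℚ.* log1+ n) ⟩
    Kx ℚ.- Ky ℚ.+ one n ℚ.* log1+² (suc m) ℚ.- log1+ (suc m) ℚ.* log1+ n
      ≡⟨ cong (λ d → d ℚ.+ one n ℚ.* log1+² (suc m) ℚ.- log1+ (suc m) ℚ.* log1+ n) (trans (K-*-log m n)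
           (cong₂ (λ p q → p ℚ.- one m ℚ.* q) (cong₂ ℚ._*_ (log^-1 (suc m)) (log^-1 n))
               (*₁-cong {g = log1+} log^-1 (λ _ → refl) (suc n)))) ⟩
    log1+ (suc m) ℚ.* log1+ n ℚ.- one m ℚ.* log1+² (suc n) ℚ.+ one n ℚ.* log1+² (suc m) ℚ.- log1+
        (suc m) ℚ.* log1+ n
      ≡⟨ solve 3 (λ t r s → t :- r :+ s :- t := s :- r) refl (log1+ (suc m) ℚ.* log1+ n)
          (one m ℚ.* log1+² (suc n)) (one n ℚ.* log1+² (suc m)) ⟩
    one n ℚ.* log1+² (suc m) ℚ.- one m ℚ.* log1+² (suc n)
      ≡⟨ cong (λ o → o ℚ.* log1+² (suc m) ℚ.- one m ℚ.* log1+² (suc n)) (var-suc n) ⟨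
    var (suc n) ℚ.* log1+² (suc m) ℚ.- one m ℚ.* log1+² (suc n) ∎
    where
    Kx Ky : ℚ
    Kx = ((λ k → K k n) *₁ log1+) m
    Ky = (K m *₁ log1+) n

    alongX : ((λ k → H k (suc n)) *₁ log1+) (suc m) ≡ Kx ℚ.+ one n ℚ.* log1+² (suc m)
    alongX = begin
      0ℚ ℚ.* log1+ (suc m) ℚ.+ ((λ k → K k n ℚ.+ one n ℚ.* log1+ (suc k)) *₁ log1+) m
        ≡⟨ cong (0ℚ ℚ.* log1+ (suc m) ℚ.+_) (trans
             (*₁-+ˡ (λ k → K k n) (λ k → one n ℚ.* log1+ (suc k)) log1+ m)
             (cong (Kx ℚ.+_) (scale-*₁ (one n) (log1+ ∘ suc) log1+ m))) ⟩
      0ℚ ℚ.* log1+ (suc m) ℚ.+ (Kx ℚ.+ one n ℚ.* ((log1+ ∘ suc) *₁ log1+) m)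
        ≡⟨ solve 4 (λ l x o s → con 0ℚ :* l :+ (x :+ o :* s) := x :+ o :* (con 0ℚ :* l :+ s))
            refl (log1+ (suc m)) Kx (one n) (((log1+ ∘ suc) *₁ log1+) m) ⟩
      Kx ℚ.+ one n ℚ.* log1+² (suc m) ∎

    alongY : (H (suc m) *₁ log1+) (suc n) ≡ Ky ℚ.+ log1+ (suc m) ℚ.* log1+ n
    alongY = begin
      0ℚ ℚ.* log1+ (suc n) ℚ.+ ((λ l → K m l ℚ.+ one l ℚ.* log1+ (suc m)) *₁ log1+) n
        ≡⟨ trans (cong₂ ℚ._+_ (ℚₚ.*-zeroˡ (log1+ (suc n)))
            (*₁-+ˡ (K m) (λ l → one l ℚ.* log1+ (suc m)) log1+ n)) (ℚₚ.+-identityˡ _) ⟩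
      Ky ℚ.+ ((λ l → one l ℚ.* log1+ (suc m)) *₁ log1+) n
        ≡⟨ cong (Ky ℚ.+_) (begin
          ((λ l → one l ℚ.* log1+ (suc m)) *₁ log1+) n     ≡⟨ *₁-cong {g = log1+}
              (λ l → ℚₚ.*-comm (one l) (log1+ (suc m))) (λ _ → refl) n ⟩
          ((λ l → log1+ (suc m) ℚ.* one l) *₁ log1+) n     ≡⟨ scale-*₁ (log1+ (suc m)) one log1+ n ⟩
          log1+ (suc m) ℚ.* log^ 1 n                       ≡⟨ cong (log1+ (suc m) ℚ.*_) (log^-1 n) ⟩
          log1+ (suc m) ℚ.* log1+ n                        ∎) ⟩
      Ky ℚ.+ log1+ (suc m) ℚ.* log1+ n ∎

  -- In degree at least 2 in y the summand y log (1 + x) of `H` has no coefficient.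
  G≡K : ∀ {G} → IsGregory G → ∀ i n → G (suc i) (suc (suc n)) ≡ K i (suc n)
  G≡K {G} gregory i n = begin
    G (suc i) (suc (suc n))                 ≡⟨ gregory-unique {G} {H} (gregoryAt {G} gregory) H-gregoryAt
        (suc i) (suc (suc n)) ⟩
    K i (suc n) ℚ.+ 0ℚ ℚ.* log1+ (suc i)    ≡⟨ solve 2 (λ k l → k :+ con 0ℚ :* l := k)
        refl (K i (suc n)) (log1+ (suc i)) ⟩
    K i (suc n)                             ∎

  -- Sums of path weights over tuples

  module _ (b : ℕ) where

    private
      N : ℕ
      N = suc b

    -- Summing over the first entry gives the recursion `w∘log`; as n < `b`, larger entries would
    -- only meet powers of the logarithm that vanish in the degree concerned.
    ∑-nonnegWeight : ∀ n l → n < b → ∑L (nonnegWeight w l) (tuples b n) ≡ log^ (suc l) (suc n)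
    ∑-nonnegWeight zero zero    _   = refl
    ∑-nonnegWeight zero (suc l) _   = sym (log^-< {suc (suc l)} {1} (s≤s (s≤s z≤n)))
    ∑-nonnegWeight (suc n) l n<b = begin
      ∑L (nonnegWeight w l) (tuples b (suc n))
        ≡⟨ ∑L-tuples b n (nonnegWeight w l) ⟩
      ∑< N (λ m → ∑L (λ v → nonnegWeight w l (m ∷ v)) (tuples b n))
        ≡⟨ ∑<-cong N (λ {m} _ → begin
          ∑L (λ v → nonnegWeight w l (m ∷ v)) (tuples b n)
            ≡⟨ ∑L-cong (λ v → unfold l m v) (tuples b n) ⟩
          ∑L (λ v → w m ℚ.* ifPositive (l + m) λ h → nonnegWeight w h v) (tuples b n)
            ≡⟨ ∑L-ifPositive (w m) (l + m) (nonnegWeight w) (tuples b n) ⟩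
          w m ℚ.* ifPositive (l + m) (λ h → ∑L (nonnegWeight w h) (tuples b n))
            ≡⟨ cong (w m ℚ.*_) (trans (ifPositive-cong (l + m)
                (λ h → ∑-nonnegWeight n h (ℕₚ.<-trans ℕₚ.≤-refl n<b))) (ifPositive-log^ (l + m) n)) ⟩
          w m ℚ.* log^ (l + m) (suc n) ∎) ⟩
      (w ∘log[ N ]) l (suc n)
        ≡⟨ w∘log l (s≤s n<b) ⟩
      log^ (suc l) (suc (suc n)) ∎
      where
      -- `nonnegWeight` matches on the height, so the equation computes only after a case split on
      -- l.
      unfold : ∀ {n} l m (v : Vec ℕ n) → nonnegWeight w l (m ∷ v) ≡ w m ℚ.* ifPositive
          (l + m) λ h → nonnegWeight w h v
      unfold zero    m v = refl
      unfold (suc l) m v = refl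

    descentStep : (ℕ → ℚ) → ℕ → ℚ
    descentStep g h = ∑< N λ m → w m ℚ.* ifPositive (suc h ∸ m) (g ∘ suc)

    -- By w∘log, descentStep is the transpose of one step of the first passage
    -- recursion; this takes the place of reversing the path.
    descentStep-transpose : ∀ g n → suc n < N →
      ∑< N (λ h → log^ h n ℚ.* descentStep g h) ≡ ∑< N (λ k → log^ k (suc n) ℚ.* g k)
    descentStep-transpose g n n<N = sym (begin
      ∑< N f
        ≡⟨ solve 2 (λ s a → s := s :- con 0ℚ :* a) refl (∑< N f) (g 0) ⟩
      ∑< N f ℚ.- f 0
        ≡⟨ ∑<-tail N {f} (trans (cong (ℚ._* g N) (log^-< n<N)) (ℚₚ.*-zeroˡ (g N))) ⟨
      ∑< N (f ∘ suc)
        ≡⟨ ∑<-cong N (λ {k} _ → trans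
             (cong (ℚ._* g (suc k)) (sym (w∘log k n<N)))
             (∑<-*ʳ N (g (suc k)) (λ m → w m ℚ.* log^ (k + m) n))) ⟩
      ∑< N (λ k → ∑< N λ m → w m ℚ.* log^ (k + m) n ℚ.* g (suc k))
        ≡⟨ ∑<-swap N N (λ k m → w m ℚ.* log^ (k + m) n ℚ.* g (suc k)) ⟩
      ∑< N (λ m → ∑< N λ k → w m ℚ.* log^ (k + m) n ℚ.* g (suc k))
        -- Substituting h = k + m: the step m - 1 from depth h leads to depth h + 1 - m = k + 1.
        ≡⟨ ∑<-cong N (λ {m} _ → ∑<-shift N m (A m) (A-zero m) (λ {h} → A-top m h)) ⟩
      ∑< N (λ m → ∑< N λ h → A m h (suc h ∸ m))
        ≡⟨ ∑<-swap N N (λ m h → A m h (suc h ∸ m)) ⟩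
      ∑< N (λ h → ∑< N λ m → A m h (suc h ∸ m))
        ≡⟨ ∑<-cong N (λ {h} _ → trans
             (∑<-cong N (λ {m} _ → solve 3 (λ w l i → w :* l :* i := l :* (w :* i))
                 refl (w m) (log^ h n) (ifPositive (suc h ∸ m) (g ∘ suc))))
             (sym (∑<-*ˡ N (log^ h n) (λ m → w m ℚ.* ifPositive (suc h ∸ m) (g ∘ suc))))) ⟩
      ∑< N (λ h → log^ h n ℚ.* descentStep g h) ∎)
      where
      f : ℕ → ℚ
      f k = log^ k (suc n) ℚ.* g k
      A : ℕ → ℕ → ℕ → ℚ
      A m h x = w m ℚ.* log^ h n ℚ.* ifPositive x (g ∘ suc)
      A-zero : ∀ m h → A m h 0 ≡ 0ℚ
      A-zero m h = ℚₚ.*-zeroʳ (w m ℚ.* log^ h n)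
      A-top : ∀ m h → N ≤ h → A m h (suc h ∸ m) ≡ 0ℚ
      A-top m h N≤h = trans
        (cong (λ l → w m ℚ.* l ℚ.* ifPositive (suc h ∸ m) (g ∘ suc))
            (log^-< (ℕₚ.<-≤-trans (ℕₚ.<-trans ℕₚ.≤-refl n<N) N≤h)))
        (solve 2 (λ w i → w :* con 0ℚ :* i := con 0ℚ) refl (w m) (ifPositive (suc h ∸ m) (g ∘ suc)))

    -- The total weight of the jump from -h and the n steps after it. Entries m ≤ h give log^0,
    -- which has no coefficient in degree n + 1.
    jump : ℕ → ℕ → ℚ
    jump n h = ∑< N λ m → w m ℚ.* log^ (m ∸ h) (suc n)

    iterateStep : ℕ → (ℕ → ℚ) → ℕ → ℚ
    iterateStep zero    g = g
    iterateStep (suc j) g = descentStep (iterateStep j g)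

    ∑-descentWeight : ∀ j n h → n < b →
                      ∑L (descentWeight w j h) (tuples b (j + suc n)) ≡ iterateStep j (jump n) h
    ∑-descentWeight zero n h n<b = begin
      ∑L (descentWeight w 0 h) (tuples b (suc n))
        ≡⟨ ∑L-tuples b n (descentWeight w 0 h) ⟩
      ∑< N (λ m → ∑L (λ v → w m ℚ.* ifPositive (m ∸ h) λ l → nonnegWeight w l v) (tuples b n))
        ≡⟨ ∑<-cong N (λ {m} _ → trans
             (∑L-ifPositive (w m) (m ∸ h) (nonnegWeight w) (tuples b n))
             (cong (w m ℚ.*_) (trans (ifPositive-cong (m ∸ h) (λ l → ∑-nonnegWeight n l n<b))
                 (ifPositive-log^ (m ∸ h) n)))) ⟩
      jump n h ∎
    ∑-descentWeight (suc j) n h n<b = begin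
      ∑L (descentWeight w (suc j) h) (tuples b (suc j + suc n))
        ≡⟨ ∑L-tuples b (j + suc n) (descentWeight w (suc j) h) ⟩
      ∑< N (λ m → ∑L (λ v → w m ℚ.* ifPositive (suc h ∸ m) λ h′ → descentWeight w j (suc h′) v)
          (tuples b (j + suc n)))
        ≡⟨ ∑<-cong N (λ {m} _ → trans
             (∑L-ifPositive (w m) (suc h ∸ m) (λ h′ → descentWeight w j (suc h′)) (tuples b (j + suc n)))
             (cong (w m ℚ.*_) (ifPositive-cong (suc h ∸ m) (λ h′ → ∑-descentWeight j n (suc h′) n<b)))) ⟩
      iterateStep (suc j) (jump n) h ∎

    -- Each transposition trades one application of `descentStep` for one more degree of the
    -- logarithm powers.
    iterateStep-log^ : ∀ j n g → n + j < N →
      ∑< N (λ h → log^ h n ℚ.* iterateStep j g h) ≡ ∑< N (λ k → log^ k (n + j) ℚ.* g k)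
    iterateStep-log^ zero    n g n<N = cong (λ m → ∑< N (λ k → log^ k m ℚ.* g k)) (sym (ℕₚ.+-identityʳ n))
    iterateStep-log^ (suc j) n g n<N rewrite ℕₚ.+-suc n j = trans
      (descentStep-transpose (iterateStep j g) n (ℕₚ.≤-<-trans (s≤s (ℕₚ.m≤m+n n j)) n<N))
      (iterateStep-log^ j (suc n) g n<N)

    -- In degree 0 the coefficient of log^h is 1 for h = 0 and 0 otherwise, so evaluating at 0 is
    -- pairing with these coefficients.
    iterateStep-0 : ∀ j g → j < N → iterateStep j g 0 ≡ ∑< N λ k → log^ k j ℚ.* g k
    iterateStep-0 j g j<N = begin
      iterateStep j g 0
        ≡⟨ solve 1 (λ a → a := con 1ℚ :* a :+ con 0ℚ) refl (iterateStep j g 0) ⟩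
      1ℚ ℚ.* iterateStep j g 0 ℚ.+ 0ℚ
        ≡⟨ cong (1ℚ ℚ.* iterateStep j g 0 ℚ.+_)
            (∑<-zero b {λ h → log^ (suc h) 0 ℚ.* iterateStep j g (suc h)} (λ {h} _ →
             trans (cong (ℚ._* iterateStep j g (suc h)) (log^-< {suc h} {0} (s≤s z≤n)))
                 (ℚₚ.*-zeroˡ (iterateStep j g (suc h))))) ⟨
      ∑< N (λ h → log^ h 0 ℚ.* iterateStep j g h)
        ≡⟨ iterateStep-log^ j 0 g j<N ⟩
      ∑< N (λ k → log^ k j ℚ.* g k) ∎

  ∑-jump : ∀ j n → ∑< (suc (j + suc n)) (λ k → log^ k j ℚ.* jump (j + suc n) n k) ≡ K j (suc n)
  ∑-jump j n = begin
    ∑< N (λ k → log^ k j ℚ.* ∑< N λ m → w m ℚ.* log^ (m ∸ k) (suc n))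
      ≡⟨ ∑<-cong N (λ {k} _ → row k) ⟩
    ∑< N (λ k → ∑< N λ l → w (l + suc k) ℚ.* (log^ k j ℚ.* log^ (suc l) (suc n)))
      ≡⟨ K-extend (s≤s (ℕₚ.m≤m+n j (suc n))) (ℕₚ.m≤n⇒m≤1+n (ℕₚ.m≤n+m (suc n) j)) ⟨
    K j (suc n) ∎
    where
    N : ℕ
    N = suc (j + suc n)
    A : ℕ → ℕ → ℚ
    A h x = w h ℚ.* log^ x (suc n)
    move : ∀ k → k ≤ j → ∑< N (λ l → A (l + suc k) (suc l)) ≡ ∑< N (λ m → A m (m ∸ k))
    move k k≤j = ∑<-shift N (suc k) A (λ h → ℚₚ.*-zeroʳ (w h)) (λ {h} N≤h → trans
      (cong (w h ℚ.*_) (log^-< (ℕₚ.m+n≤o⇒m≤o∸n (suc (suc n))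
          (ℕₚ.≤-trans (ℕₚ.+-monoʳ-≤ (suc (suc n)) k≤j)
              (ℕₚ.≤-trans (ℕₚ.≤-reflexive (cong suc (ℕₚ.+-comm (suc n) j))) N≤h)))))
      (ℚₚ.*-zeroʳ (w h)))
    row : ∀ k → log^ k j ℚ.* ∑< N (λ m → A m (m ∸ k)) ≡ ∑< N
        (λ l → w (l + suc k) ℚ.* (log^ k j ℚ.* log^ (suc l) (suc n)))
    -- The substitution m = l + k + 1 in `move` stays within the truncation only for k ≤ j; for
    -- larger k the factor `log^ k j` makes both sides 0.
    row k with k ℕₚ.≤? j
    ... | yes k≤j = begin
      log^ k j ℚ.* ∑< N (λ m → A m (m ∸ k))
        ≡⟨ cong (log^ k j ℚ.*_) (move k k≤j) ⟨
      log^ k j ℚ.* ∑< N (λ l → A (l + suc k) (suc l))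
        ≡⟨ ∑<-*ˡ N (log^ k j) (λ l → A (l + suc k) (suc l)) ⟩
      ∑< N (λ l → log^ k j ℚ.* A (l + suc k) (suc l))
        ≡⟨ ∑<-cong N (λ {l} _ → solve 3 (λ q w r → q :* (w :* r) := w :* (q :* r))
            refl (log^ k j) (w (l + suc k)) (log^ (suc l) (suc n))) ⟩
      ∑< N (λ l → w (l + suc k) ℚ.* (log^ k j ℚ.* log^ (suc l) (suc n))) ∎
    ... | no k≰j = begin
      log^ k j ℚ.* ∑< N (λ m → A m (m ∸ k))
        ≡⟨ trans (cong (ℚ._* ∑< N (λ m → A m (m ∸ k))) log≡0) (ℚₚ.*-zeroˡ (∑< N (λ m → A m (m ∸ k)))) ⟩
      0ℚ
        ≡⟨ ∑<-zero N (λ {l} _ → trans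
             (cong (λ q → w (l + suc k) ℚ.* (q ℚ.* log^ (suc l) (suc n))) log≡0)
             (solve 2 (λ w r → w :* (con 0ℚ :* r) := con 0ℚ) refl (w (l + suc k)) (log^ (suc l) (suc n)))) ⟨
      ∑< N (λ l → w (l + suc k) ℚ.* (log^ k j ℚ.* log^ (suc l) (suc n))) ∎
      where
      log≡0 : log^ k j ≡ 0ℚ
      log≡0 = log^-< (ℕₚ.≰⇒> k≰j)

  -- Here i = j + 1 and r = j + 1 + n: j steps, the jump, and n further steps.
  C≡K : ∀ j n → C B (suc j) (j + suc n) ≡ K j (suc n)
  C≡K j n = begin
    -1^ r ℚ.* ∑L (weight t) (List.filter adm? (tuples r r))
      ≡⟨ ∑L-*ˡ (-1^ r) (weight t) (List.filter adm? (tuples r r)) ⟨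
    ∑L (λ v → -1^ r ℚ.* weight t v) (List.filter adm? (tuples r r))
      ≡⟨ ∑L-filter adm? indicates (tuples r r) ⟩
    ∑L (descentWeight w j 0) (tuples r r)
      ≡⟨ ∑-descentWeight r j n 0 (ℕₚ.m≤n+m (suc n) j) ⟩
    iterateStep r j (jump r n) 0
      ≡⟨ iterateStep-0 r j (jump r n) (s≤s (ℕₚ.m≤m+n j (suc n))) ⟩
    ∑< (suc r) (λ k → log^ k j ℚ.* jump r n k)
      ≡⟨ ∑-jump j n ⟩
    K j (suc n) ∎
    where
    r : ℕ
    r = j + suc n
    t : Series
    t k = B k ℚ.* 1/ k !
    adm? : (v : Vec ℕ r) → _
    adm? = admissible? (suc j) r
    indicates : ∀ v → Indicates (Admissible (suc j) r v) (-1^ r ℚ.* weight t v) (descentWeight w j 0 v)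
    -- `Admissible (suc j) r v` and `Descent j 0 v` agree by computation; the first component of `p`
    -- identifies the sign (-1)^r with that of the total.
    indicates v = (λ p → trans (accept ind p)
        (trans (sym (weight-sign t v)) (cong (λ s → -1^ s ℚ.* weight t v) (proj₁ p)))) , reject ind
      where
      ind : Indicates (Descent j 0 v) (weight w v) (descentWeight w j 0 v)
      ind = descentWeight-indicates w j 0 v (ℕₚ.≤-trans (s≤s (ℕₚ.m≤m+n j n)) (ℕₚ.≤-reflexive (sym (ℕₚ.+-suc j n))))

theorem4p2 : (B : ℕ → ℚ) → IsBernoulli B →
    (G : ℕ → ℕ → ℚ) → IsGregory G →
    ∀ i r → 1 ≤ i → i ≤ r →
    C B i r ≡ G i (r ∸ i + 2)
theorem4p2 B bernoulli G gregory (suc j) r _ i≤r = begin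
  -- With n = r - i the degree r - i + 2 in y is n + 2: one factor y comes from x y in `H`, the
  -- others from degree n + 1 of `K`.
  C B (suc j) r                         ≡⟨ cong (C B (suc j)) (ℕₚ.m+[n∸m]≡n i≤r) ⟨
  C B (suc j) (suc j + n)               ≡⟨ cong (C B (suc j)) (ℕₚ.+-suc j n) ⟨
  C B (suc j) (j + suc n)               ≡⟨ C≡K B bernoulli j n ⟩
  K B bernoulli j (suc n)               ≡⟨ G≡K B bernoulli {G} gregory j n ⟨
  G (suc j) (2 + n)                     ≡⟨ cong (G (suc j)) (ℕₚ.+-comm 2 n) ⟩
  G (suc j) (n + 2)                     ∎
  where
  n : ℕ
  n = r ∸ suc j
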